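{- Let $V$ be a finite-dimensional real vector space and let $W\subset GL(V)$ be a finite Coxeter group, i.e. a finite group generated by reflections of $V$. Then $\mathcal R_2W=\mathsf{Alt}(W)$.
   Context: For $g\in GL(V)$ of finite order, $V^{\langle g\rangle}$ is the subspace of vectors fixed by $g$. A reflection is a finite order element $g\in GL(V)$ with $\operatorname{codim}V^{\langle g\rangle}=1$; a rotation is a finite order element with $\operatorname{codim}V^{\langle g\rangle}=2$. $\mathcal R_2W$ is the subgroup of $W$ generated by the rotations contained in $W$. The alternating subgroup $\mathsf{Alt}(W)$ is the kernel of the determinant map $\det:W\to\mathbb R^\times$. -}

module Defs where

open import Algebra.Bundles using (CommutativeRing; Group; Monoid; Semiring)
open import Algebra.Module.Bundles using (Module)
import Algebra.Definitions.RawMonoid as RawMonoidDefinitions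
import Algebra.Definitions.RawSemiring as RawSemiringDefinitions
import Algebra.Module.Morphism.Structures as ModuleMorphismStructures
import Algebra.Module.Morphism.Construct.Composition as Composition
import Algebra.Module.Morphism.Construct.Identity as Identity
open import Data.Fin.Base using (Fin; zero; suc; toℕ; punchIn)
open import Data.List.Base using (List)
import Data.List.Membership.Setoid as SetoidMembership
open import Data.Nat.Base as ℕ using (ℕ)
open import Data.Product.Base using (Σ; ∃-syntax; _×_; _,_; proj₁; proj₂)
open import Data.Vec.Functional using (Vector)
open import Function.Base using (_∘_; id)
open import Level using (Level; _⊔_) renaming (suc to lsuc)
open import Relation.Binary.Core using (Rel)
open import Relation.Binary.PropositionalEquality.Core using (_≡_)
open import Relation.Binary.Structures using (IsStrictTotalOrder)
open import Relation.Nullary.Negation.Core using (¬_)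
open import Relation.Unary using (Pred; _∈_; _∩_; _≐_; Satisfiable; U)

private
  variable
    c ℓ ℓ₁ ℓ₂ m ℓm s w : Level

-- The real numbers, given by their second-order axioms (a Dedekind-complete
-- ordered field), which determine them up to unique isomorphism.  The order
-- axioms are the classical ones: trichotomy is part of IsStrictTotalOrder.
record RealField (c ℓ₁ ℓ₂ : Level) : Set (lsuc (c ⊔ ℓ₁ ⊔ ℓ₂)) where
  infix 4 _<_
  field
    commutativeRing : CommutativeRing c ℓ₁

  open CommutativeRing commutativeRing public

  field
    _<_                : Rel Carrier ℓ₂
    isStrictTotalOrder : IsStrictTotalOrder _≈_ _<_
    0<1                : 0# < 1#
    +-monoˡ-<          : ∀ z {x y} → x < y → x + z < y + z
    *-pos              : ∀ {x y} → 0# < x → 0# < y → 0# < x * y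
    inverse            : ∀ x → ¬ (x ≈ 0#) → ∃[ y ] x * y ≈ 1#

  infix 4 _≤_
  _≤_ : Rel Carrier ℓ₂
  x ≤ y = ¬ (y < x)

  UpperBound : Pred Carrier s → Pred Carrier (c ⊔ ℓ₂ ⊔ s)
  UpperBound P u = ∀ x → x ∈ P → x ≤ u

  IsSupremum : Pred Carrier s → Pred Carrier (c ⊔ ℓ₂ ⊔ s)
  IsSupremum P u = u ∈ UpperBound P × (∀ v → v ∈ UpperBound P → u ≤ v)

  field
    complete : (P : Pred Carrier (c ⊔ ℓ₁ ⊔ ℓ₂)) →
               Satisfiable P → Satisfiable (UpperBound P) → Satisfiable (IsSupremum P)

module GroupTheory (G : Group c ℓ) where
  open Group G hiding (identity; inverse)
  open RawMonoidDefinitions rawMonoid using () renaming (_×_ to _times_)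

  infixl 8 _^_
  _^_ : Carrier → ℕ → Carrier
  g ^ k = k times g

  HasFiniteOrder : Pred Carrier ℓ
  HasFiniteOrder g = ∃[ k ] g ^ ℕ.suc k ≈ ε

  data ⟨_⟩ (S : Pred Carrier s) : Pred Carrier (c ⊔ ℓ ⊔ s) where
    generator : ∀ {g} → g ∈ S → g ∈ ⟨ S ⟩
    respects  : ∀ {g h} → g ≈ h → g ∈ ⟨ S ⟩ → h ∈ ⟨ S ⟩
    identity  : ε ∈ ⟨ S ⟩
    product   : ∀ {g h} → g ∈ ⟨ S ⟩ → h ∈ ⟨ S ⟩ → g ∙ h ∈ ⟨ S ⟩
    inverse   : ∀ {g} → g ∈ ⟨ S ⟩ → g ⁻¹ ∈ ⟨ S ⟩

  -- The elements of W are, up to ≈, exactly the entries of some list.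
  IsFinite : Pred Carrier w → Set (c ⊔ ℓ ⊔ w)
  IsFinite W = ∃[ gs ] W ≐ (λ g → g ∈ˡ gs)
    where open SetoidMembership setoid using () renaming (_∈_ to _∈ˡ_)

module Matrices (R : CommutativeRing c ℓ) where
  open CommutativeRing R using (Carrier; _*_; -_; 1#; +-monoid; semiring)
  open RawMonoidDefinitions (Monoid.rawMonoid +-monoid) using (sum)
  open RawSemiringDefinitions (Semiring.rawSemiring semiring) using (_^_)

  SquareMatrix : ℕ → Set c
  SquareMatrix n = Fin n → Fin n → Carrier

  -- Laplace expansion along the first row; the matrix argument of the recursive
  -- call is the minor deleting row zero and column j.
  determinant : ∀ n → SquareMatrix n → Carrier
  determinant ℕ.zero    M = 1#
  determinant (ℕ.suc n) M = sum λ j →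
    (- 1#) ^ toℕ j * (M zero j * determinant n (λ i k → M (suc i) (punchIn j k)))

module GeneralLinear {R : CommutativeRing c ℓ} (V : Module R m ℓm) where
  open CommutativeRing R using (Carrier)
  open Module V
  open ModuleMorphismStructures.ModuleMorphisms rawModule rawModule

  record Automorphism : Set (c ⊔ m ⊔ ℓm) where
    field
      ⟦_⟧                 : Carrierᴹ → Carrierᴹ
      isModuleIsomorphism : IsModuleIsomorphism ⟦_⟧
    open IsModuleIsomorphism isModuleIsomorphism public

  open Automorphism public using (⟦_⟧)

  private
    module A = Automorphism

    _≈ᴬ_ : Rel Automorphism (m ⊔ ℓm)
    g ≈ᴬ h = ∀ v → ⟦ g ⟧ v ≈ᴹ ⟦ h ⟧ v

    _∘ᴬ_ : Automorphism → Automorphism → Automorphism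
    g ∘ᴬ h = record
      { ⟦_⟧                 = ⟦ g ⟧ ∘ ⟦ h ⟧
      ; isModuleIsomorphism = Composition.isModuleIsomorphism ≈ᴹ-trans
          (A.isModuleIsomorphism h) (A.isModuleIsomorphism g)
      }

    idᴬ : Automorphism
    idᴬ = record
      { ⟦_⟧                 = id
      ; isModuleIsomorphism = Identity.isModuleIsomorphism rawModule ≈ᴹ-refl
      }

    module Inverse (g : Automorphism) where
      open A g using (⟦⟧-cong; +ᴹ-homo; 0ᴹ-homo; -ᴹ-homo; *ₗ-homo; *ᵣ-homo; injective; surjective)

      inv : Carrierᴹ → Carrierᴹ
      inv v = proj₁ (surjective v)

      rightInv : ∀ v → ⟦ g ⟧ (inv v) ≈ᴹ v
      rightInv v = proj₂ (surjective v) ≈ᴹ-refl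

      leftInv : ∀ v → inv (⟦ g ⟧ v) ≈ᴹ v
      leftInv v = injective (rightInv (⟦ g ⟧ v))

      unique : ∀ {u v} → ⟦ g ⟧ u ≈ᴹ v → inv v ≈ᴹ u
      unique {u} {v} gu≈v = injective (≈ᴹ-trans (rightInv v) (≈ᴹ-sym gu≈v))

      inv-cong : ∀ {u v} → u ≈ᴹ v → inv u ≈ᴹ inv v
      inv-cong {u} {v} u≈v = unique (≈ᴹ-trans (rightInv v) (≈ᴹ-sym u≈v))

      inv-+ : ∀ u v → inv (u +ᴹ v) ≈ᴹ inv u +ᴹ inv v
      inv-+ u v = unique (≈ᴹ-trans (+ᴹ-homo (inv u) (inv v)) (+ᴹ-cong (rightInv u) (rightInv v)))

      inv-0 : inv 0ᴹ ≈ᴹ 0ᴹ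
      inv-0 = unique 0ᴹ-homo

      inv-neg : ∀ v → inv (-ᴹ v) ≈ᴹ -ᴹ inv v
      inv-neg v = unique (≈ᴹ-trans (-ᴹ-homo (inv v)) (-ᴹ‿cong (rightInv v)))

      inv-*ₗ : ∀ a v → inv (a *ₗ v) ≈ᴹ a *ₗ inv v
      inv-*ₗ a v = unique (≈ᴹ-trans (*ₗ-homo a (inv v)) (*ₗ-congˡ (rightInv v)))

      inv-*ᵣ : ∀ a v → inv (v *ᵣ a) ≈ᴹ inv v *ᵣ a
      inv-*ᵣ a v = unique (≈ᴹ-trans (*ᵣ-homo a (inv v)) (*ᵣ-congʳ (rightInv v)))

      inverse : Automorphism
      inverse = record
        { ⟦_⟧                 = inv
        ; isModuleIsomorphism = record
          { isModuleMonomorphism = record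
            { isModuleHomomorphism = record
              { isBimoduleHomomorphism = record
                { +ᴹ-isGroupHomomorphism = record
                  { isMonoidHomomorphism = record
                    { isMagmaHomomorphism = record
                      { isRelHomomorphism = record { cong = inv-cong }
                      ; homo = inv-+
                      }
                    ; ε-homo = inv-0
                    }
                  ; ⁻¹-homo = inv-neg
                  }
                ; *ₗ-homo = inv-*ₗ
                ; *ᵣ-homo = inv-*ᵣ
                }
              }
            ; injective = λ {u} {v} p →
                ≈ᴹ-trans (≈ᴹ-sym (rightInv u)) (≈ᴹ-trans (⟦⟧-cong p) (rightInv v))
            }
          ; surjective = λ v → ⟦ g ⟧ v , λ p → ≈ᴹ-trans (inv-cong p) (leftInv v)
          }
        }

  GL : Group (c ⊔ m ⊔ ℓm) (m ⊔ ℓm)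
  GL = record
    { Carrier = Automorphism
    ; _≈_     = _≈ᴬ_
    ; _∙_     = _∘ᴬ_
    ; ε       = idᴬ
    ; _⁻¹     = Inverse.inverse
    ; isGroup = record
      { isMonoid = record
        { isSemigroup = record
          { isMagma = record
            { isEquivalence = record
              { refl  = λ _ → ≈ᴹ-refl
              ; sym   = λ p v → ≈ᴹ-sym (p v)
              ; trans = λ p q v → ≈ᴹ-trans (p v) (q v)
              }
            ; ∙-cong = λ {g} {_} {_} {h} p q v → ≈ᴹ-trans (A.⟦⟧-cong g (q v)) (p (⟦ h ⟧ v))
            }
          ; assoc = λ _ _ _ _ → ≈ᴹ-refl
          }
        ; identity = (λ _ _ → ≈ᴹ-refl) , (λ _ _ → ≈ᴹ-refl)
        }
      ; inverse = Inverse.leftInv , Inverse.rightInv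
      ; ⁻¹-cong = λ {g} {h} p v → Inverse.unique g
          (≈ᴹ-trans (p (Inverse.inv h v)) (Inverse.rightInv h v))
      }
    }

module Dimension {R : CommutativeRing c ℓ} (V : Module R m ℓm) where
  open CommutativeRing R using (Carrier; _≈_; 0#)
  open Module V
  open RawMonoidDefinitions +ᴹ-rawMonoid using () renaming (sum to sumᴹ)

  linearCombination : ∀ {n} → Vector Carrier n → Vector Carrierᴹ n → Carrierᴹ
  linearCombination a b = sumᴹ λ i → a i *ₗ b i

  record IsBasis {n} (S : Pred Carrierᴹ s) (b : Vector Carrierᴹ n) : Set (c ⊔ ℓ ⊔ m ⊔ ℓm ⊔ s) where
    field
      within      : ∀ i → b i ∈ S
      independent : ∀ a → linearCombination a b ≈ᴹ 0ᴹ → ∀ i → a i ≈ 0#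
      spanning    : ∀ v → v ∈ S → ∃[ a ] linearCombination a b ≈ᴹ v

  HasDimension : Pred Carrierᴹ s → ℕ → Set (c ⊔ ℓ ⊔ m ⊔ ℓm ⊔ s)
  HasDimension S n = Σ (Vector Carrierᴹ n) (IsBasis S)

  record FiniteDimensional : Set (c ⊔ ℓ ⊔ m ⊔ ℓm) where
    field
      dimension : ℕ
      basis     : Vector Carrierᴹ dimension
      isBasis   : IsBasis U basis

    coordinates : Carrierᴹ → Vector Carrier dimension
    coordinates v = proj₁ (IsBasis.spanning isBasis v _)

module Reflections {R : CommutativeRing c ℓ} (V : Module R m ℓm)
                   (fd : Dimension.FiniteDimensional V) where
  open CommutativeRing R using (Carrier; _≈_; 1#)
  open Module V using (Carrierᴹ; _≈ᴹ_)
  open GeneralLinear V using (GL; Automorphism; ⟦_⟧)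
  open GroupTheory GL using (HasFiniteOrder; ⟨_⟩; IsFinite)
  open Dimension V using (HasDimension; module FiniteDimensional)
  open FiniteDimensional fd
  open Matrices R

  HasCodimension : Pred Carrierᴹ s → ℕ → Set (c ⊔ ℓ ⊔ m ⊔ ℓm ⊔ s)
  HasCodimension S k = ∃[ d ] HasDimension S d × d ℕ.+ k ≡ dimension

  FixedSpace : Automorphism → Pred Carrierᴹ ℓm
  FixedSpace g v = ⟦ g ⟧ v ≈ᴹ v

  IsReflection : Pred Automorphism (c ⊔ ℓ ⊔ m ⊔ ℓm)
  IsReflection g = HasFiniteOrder g × HasCodimension (FixedSpace g) 1

  IsRotation : Pred Automorphism (c ⊔ ℓ ⊔ m ⊔ ℓm)
  IsRotation g = HasFiniteOrder g × HasCodimension (FixedSpace g) 2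

  -- Matrix of g in the basis of fd: column j holds the coordinates of the image
  -- of basis j.  det does not depend on this choice of basis.
  matrix : Automorphism → SquareMatrix dimension
  matrix g i j = coordinates (⟦ g ⟧ (basis j)) i

  det : Automorphism → Carrier
  det g = determinant dimension (matrix g)

  -- generatedByReflections also says that W is a subgroup, and closed under ≈.
  record IsFiniteCoxeterGroup (W : Pred Automorphism w) : Set (c ⊔ ℓ ⊔ m ⊔ ℓm ⊔ w) where
    field
      finite                 : IsFinite W
      generatedByReflections : W ≐ ⟨ W ∩ IsReflection ⟩

  𝓡₂ : Pred Automorphism w → Pred Automorphism (c ⊔ ℓ ⊔ m ⊔ ℓm ⊔ w)
  𝓡₂ W = ⟨ W ∩ IsRotation ⟩

  Alt : Pred Automorphism w → Pred Automorphism (ℓ ⊔ w)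
  Alt W = W ∩ (λ g → det g ≈ 1#)

{-# OPTIONS --safe #-}
module Submission where

-- A reflection has the form s v = v - φ(v) α with φ(α) = 2, hence det s = -1,
-- so by multiplicativity of the determinant Alt W consists of the products of
-- an even number of reflections.  For reflections s, s′ of W either s s′ = 1 or
-- the fixed space of s s′ is the intersection of two distinct hyperplanes: when
-- the hyperplanes or the roots coincide, s s′ is unipotent of finite order.
--
-- Conversely a rotation r acts on V / V^r, of dimension 2, with determinant
-- det r = ±1 and without nonzero fixed vectors (again because unipotent elements
-- have infinite order).  If det r = -1, Cayley–Hamilton gives r² = t r + 1 there.
-- For t = 0 the vectors r v + v are fixed, so r = -1 and det r = 1.  For t ≠ 0 a
-- coordinate x_k of r^k v satisfies x_{k+2} = t x_{k+1} + x_k, and t x_k x_{k+1}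
-- grows by (t x_{k+1})² at each step, which contradicts periodicity.

open import Defs
open import Level using (Level; _⊔_)
open import Relation.Unary using (Pred; _∩_; _≐_; _∈_)
open import Algebra.Module.Bundles using (Module)
open import Algebra.Bundles using (CommutativeRing; Group; Semiring)
import Algebra.Definitions.RawSemiring as RawSemiringDefinitions
import Algebra.Properties.AbelianGroup as AbelianGroupProperties
import Algebra.Properties.CommutativeMonoid.Sum as CommutativeMonoidSum
import Algebra.Properties.Group as GroupProperties
import Algebra.Properties.Monoid.Mult as MonoidMultiplication
import Algebra.Properties.Monoid.Mult.TCOptimised as MonoidMult
import Algebra.Properties.Ring as RingProperties
import Algebra.Properties.Semiring.Mult.TCOptimised as SemiringMult
import Algebra.Properties.Semiring.Sum as SemiringSum
import Algebra.Solver.Ring as RingSolver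
open import Algebra.Solver.Ring.AlmostCommutativeRing
  using (fromCommutativeRing; _-Raw-AlmostCommutative⟶_)
open import Data.Empty using (⊥; ⊥-elim)
open import Data.Fin.Base using (Fin; zero; suc; toℕ; punchIn; lift)
open import Data.Fin.Patterns using (0F; 1F; 2F; 3F; 4F)
open import Data.Fin.Properties using (any?; pigeonhole)
open import Data.Integer.Base as ℤ using (ℤ; +_; -[1+_])
import Data.Integer.Properties as ℤ
import Data.List.Base as List
import Data.List.Relation.Unary.Any as Any
import Data.List.Relation.Unary.Any.Properties as Any
open import Data.Maybe.Base using (Maybe; just; nothing)
open import Data.Nat.Base as ℕ using (ℕ; zero; suc)
import Data.Nat.Properties as ℕ
open import Data.Product.Base using (_×_; _,_; proj₁; proj₂; ∃-syntax)
open import Data.Sum.Base using (_⊎_; inj₁; inj₂; [_,_]′)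
open import Data.Unit.Polymorphic.Base using (⊤; tt)
open import Data.Vec.Base using (Vec; lookup; []) renaming (_∷_ to _▸_)
open import Data.Vec.Functional using (Vector; _∷_; tail; insertAt; removeAt)
open import Data.Vec.Functional.Properties using (insertAt-lookup; insertAt-punchIn)
open import Function.Base using (_∘_)
open import Relation.Binary.Definitions using (tri<; tri≈; tri>)
open import Relation.Binary.PropositionalEquality.Core as ≡ using (_≡_; _≗_)
import Relation.Binary.Reasoning.Setoid as SetoidReasoning
open import Relation.Binary.Structures using (IsStrictTotalOrder)
open import Relation.Nullary.Decidable.Core using (yes; no; ¬?; decidable-stable)
open import Relation.Nullary.Negation.Core using (¬_)

-- An invariant inner product would give orthogonal complements of fixed spaces. Its place is taken
-- by the following fact: if g has finite order and g fixes g v - v, then g v = v. Hence an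
-- arbitrary complement of V^g suffices, and V / V^g is handled through coordinates along it,
-- without forming the quotient. The second obstacle is that `det` is a Laplace expansion along the
-- first row in one chosen basis. Multiplicativity and independence of the basis are derived from
-- the uniqueness of alternating forms up to their value on the unit rows. Equality in ℝ is
-- decidable by trichotomy, which provides pivots, the case split on t and the test for equal
-- hyperplanes. No words in reflections are counted: an element of `W` is kept in the form h or s h
-- with h in `𝓡₂ W`.

private
  variable
    c ℓ ℓ₁ ℓ₂ μ ℓμ ω : Level

-- Ring identities with integer coefficients

-- Integer coefficients let the ring solver cancel terms, which it cannot do with
-- the elements of an abstract ring as coefficients: their equality does not compute.
module IntegerSolver (R : CommutativeRing c ℓ) where
  open CommutativeRing R hiding (zero)
  open RingProperties ring using (-‿distribˡ-*; -‿distribʳ-*; -‿involutive; -0#≈0#)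
  open AbelianGroupProperties +-abelianGroup using () renaming (⁻¹-∙-comm to -‿+-comm)
  open MonoidMult +-monoid using (×-homo-+; 1+×) renaming (_×_ to _times_)
  open SemiringMult semiring using (×1-homo-*)
  open SetoidReasoning setoid

  embed : ℤ → Carrier
  embed (+ n)    = n times 1#
  embed -[1+ n ] = - (suc n times 1#)

  private
    cancel-1 : ∀ x y → (1# + x) - (1# + y) ≈ x - y
    cancel-1 x y = begin
      (1# + x) - (1# + y)       ≈⟨ +-cong (+-comm 1# x) (sym (-‿+-comm 1# y)) ⟩
      (x + 1#) + (- 1# + - y)   ≈⟨ +-assoc x 1# _ ⟩
      x + (1# + (- 1# + - y))   ≈⟨ +-congˡ (+-assoc 1# (- 1#) (- y)) ⟨
      x + ((1# - 1#) + - y)     ≈⟨ +-congˡ (+-congʳ (-‿inverseʳ 1#)) ⟩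
      x + (0# + - y)            ≈⟨ +-congˡ (+-identityˡ (- y)) ⟩
      x - y                     ∎

    embed-⊖ : ∀ m n → embed (m ℤ.⊖ n) ≈ m times 1# - n times 1#
    embed-⊖ zero    zero    = sym (-‿inverseʳ 0#)
    embed-⊖ zero    (suc n) = sym (+-identityˡ _)
    embed-⊖ (suc m) zero    = sym (trans (+-congˡ -0#≈0#) (+-identityʳ _))
    embed-⊖ (suc m) (suc n) = begin
      embed (suc m ℤ.⊖ suc n)               ≡⟨ ≡.cong embed (ℤ.[1+m]⊖[1+n]≡m⊖n m n) ⟩
      embed (m ℤ.⊖ n)                       ≈⟨ embed-⊖ m n ⟩
      m times 1# - n times 1#                       ≈⟨ cancel-1 _ _ ⟨
      (1# + m times 1#) - (1# + n times 1#)         ≈⟨ +-cong (1+× m 1#) (-‿cong (1+× n 1#)) ⟨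
      suc m times 1# - suc n times 1#               ∎

    embed-neg : ∀ i → embed (ℤ.- i) ≈ - embed i
    embed-neg (+ zero)  = sym -0#≈0#
    embed-neg (+ suc n) = refl
    embed-neg -[1+ n ]  = sym (-‿involutive _)

    embed-+ : ∀ i j → embed (i ℤ.+ j) ≈ embed i + embed j
    embed-+ (+ m)    (+ n)    = ×-homo-+ 1# m n
    embed-+ (+ m)    -[1+ n ] = embed-⊖ m (suc n)
    embed-+ -[1+ m ] (+ n)    = trans (embed-⊖ n (suc m)) (+-comm _ _)
    embed-+ -[1+ m ] -[1+ n ] = begin
      - ((2 ℕ.+ (m ℕ.+ n)) times 1#)      ≡⟨ ≡.cong (λ k → - (suc k times 1#)) (≡.sym (ℕ.+-suc m n)) ⟩
      - ((suc m ℕ.+ suc n) times 1#)      ≈⟨ -‿cong (×-homo-+ 1# (suc m) (suc n)) ⟩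
      - (suc m times 1# + suc n times 1#)     ≈⟨ -‿+-comm _ _ ⟨
      - (suc m times 1#) - (suc n times 1#)   ∎

    embed-* : ∀ i j → embed (i ℤ.* j) ≈ embed i * embed j
    embed-* (+ m) (+ n) rewrite ℤ.+◃n≡+n (m ℕ.* n) = ×1-homo-* m n
    embed-* (+ m) -[1+ n ] rewrite ℤ.-◃n≡-n (m ℕ.* suc n) =
      trans (embed-neg (+ (m ℕ.* suc n))) (trans (-‿cong (×1-homo-* m (suc n))) (-‿distribʳ-* _ _))
    embed-* -[1+ m ] (+ n) rewrite ℤ.-◃n≡-n (suc m ℕ.* n) =
      trans (embed-neg (+ (suc m ℕ.* n))) (trans (-‿cong (×1-homo-* (suc m) n)) (-‿distribˡ-* _ _))
    embed-* -[1+ m ] -[1+ n ] = begin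
      (suc m ℕ.* suc n) times 1#               ≈⟨ ×1-homo-* (suc m) (suc n) ⟩
      (suc m times 1#) * (suc n times 1#)          ≈⟨ -‿involutive _ ⟨
      - - ((suc m times 1#) * (suc n times 1#))    ≈⟨ -‿cong (-‿distribˡ-* _ _) ⟩
      - (- (suc m times 1#) * (suc n times 1#))    ≈⟨ -‿distribʳ-* _ _ ⟩
      - (suc m times 1#) * - (suc n times 1#)      ∎

    morphism : ℤ.+-*-rawRing -Raw-AlmostCommutative⟶ fromCommutativeRing R
    morphism = record
      { ⟦_⟧    = embed
      ; +-homo = embed-+
      ; *-homo = embed-*
      ; -‿homo = embed-neg
      ; 0-homo = refl
      ; 1-homo = refl
      }

    embed≟ : ∀ i j → Maybe (embed i ≈ embed j)
    embed≟ i j with i ℤ.≟ j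
    ... | yes i≡j = just (reflexive (≡.cong embed i≡j))
    ... | no  _   = nothing

  open RingSolver ℤ.+-*-rawRing (fromCommutativeRing R) morphism embed≟ public

-- Determinants as alternating forms in the rows

module Determinants (R : CommutativeRing c ℓ) where
  open CommutativeRing R hiding (zero)
  open Matrices R public
  open SemiringSum semiring
    using (sum; sum-cong-≋; sum-replicate-zero; ∑-distrib-+; *-distribˡ-sum)
  open RawSemiringDefinitions (Semiring.rawSemiring semiring) using (_^_)
  open SetoidReasoning setoid
  private
    module S = IntegerSolver R
  open S using (_:+_; _:*_; :-_; _:=_; con)

  private
    variable
      m n k : ℕ

  Row : ℕ → Set c
  Row n = Vector Carrier n

  infix 4 _≋_
  _≋_ : Row n → Row n → Set ℓ
  x ≋ y = ∀ j → x j ≈ y j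

  sum-zero : {x : Row n} → (∀ j → x j ≈ 0#) → sum x ≈ 0#
  sum-zero {n} x≈0 = trans (sum-cong-≋ x≈0) (sum-replicate-zero n)

  unit : Fin n → Row n
  unit zero    zero    = 1#
  unit zero    (suc _) = 0#
  unit (suc _) zero    = 0#
  unit (suc i) (suc j) = unit i j

  unit-sym : ∀ (i j : Fin n) → unit j i ≈ unit i j
  unit-sym zero    zero    = refl
  unit-sym zero    (suc _) = refl
  unit-sym (suc _) zero    = refl
  unit-sym (suc i) (suc j) = unit-sym i j

  sum-unit : ∀ (x : Row n) k → sum (λ j → x j * unit j k) ≈ x k
  sum-unit x zero = begin
    x zero * 1# + sum (λ j → x (suc j) * 0#)  ≈⟨ +-cong (*-identityʳ _) (sum-zero (λ j → zeroʳ (x (suc j)))) ⟩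
    x zero + 0#                               ≈⟨ +-identityʳ _ ⟩
    x zero                                    ∎
  sum-unit x (suc k) = begin
    x zero * 0# + sum (λ j → x (suc j) * unit j k)  ≈⟨ +-cong (zeroʳ _) (sum-unit (tail x) k) ⟩
    0# + x (suc k)                                  ≈⟨ +-identityˡ _ ⟩
    x (suc k)                                       ∎

  sum-unitˡ : ∀ (x : Row n) i → sum (λ j → unit i j * x j) ≈ x i
  sum-unitˡ x zero = begin
    1# * x zero + sum (λ j → 0# * x (suc j))  ≈⟨ +-cong (*-identityˡ _) (sum-zero (λ j → zeroˡ (x (suc j)))) ⟩
    x zero + 0#                               ≈⟨ +-identityʳ _ ⟩
    x zero                                    ∎
  sum-unitˡ x (suc i) = begin
    0# * x zero + sum (λ j → unit i j * x (suc j))  ≈⟨ +-cong (zeroˡ _) (sum-unitˡ (tail x) i) ⟩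
    0# + x (suc i)                                  ≈⟨ +-identityˡ _ ⟩
    x (suc i)                                       ∎

  Form : ℕ → ℕ → Set c
  Form m n = Vector (Row n) m → Carrier

  Congruent : Form m n → Set (c ⊔ ℓ)
  Congruent F = ∀ {M N} → (∀ i → M i ≋ N i) → F M ≈ F N

  LinearInFirst : Form (suc m) n → Set (c ⊔ ℓ)
  LinearInFirst F = ∀ a x y r → F ((λ j → a * x j + y j) ∷ r) ≈ a * F (x ∷ r) + F (y ∷ r)

  -- The index i is always zero; it is quantified over so that the condition is
  -- vacuous, rather than ill-typed, for forms in one variable.
  VanishesOnFirstTwo : Form (suc m) n → Set (c ⊔ ℓ)
  VanishesOnFirstTwo {m} F = ∀ M (i : Fin m) → toℕ i ≡ 0 → M zero ≋ M (suc i) → F M ≈ 0#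

  -- The conditions concern the first two rows only, but are imposed again after each initial row is
  -- fixed. This yields linearity in every row and vanishing on equal neighbours, in a shape that
  -- suits induction along the first row.
  IsAlternating : ∀ m → Form m n → Set (c ⊔ ℓ)
  IsAlternating zero    F = ⊤
  IsAlternating (suc m) F = LinearInFirst F × VanishesOnFirstTwo F × (∀ x → IsAlternating m (F ∘ (x ∷_)))

  ∷-cong : ∀ {x y : Row n} {r s : Vector (Row n) m} → x ≋ y → (∀ i → r i ≋ s i) →
           ∀ i → (x ∷ r) i ≋ (y ∷ s) i
  ∷-cong p q zero    = p
  ∷-cong p q (suc i) = q i

  -- The two families agree entry by entry but are not the same function, which is why `Congruent`
  -- accompanies `IsAlternating` below.
  ∘-∷ : ∀ (T : Row n → Row k) x (r : Vector (Row n) m) → ∀ i → (T ∘ (x ∷ r)) i ≋ (T x ∷ (T ∘ r)) i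
  ∘-∷ T x r zero    j = refl
  ∘-∷ T x r (suc i) j = refl

  fix-first-cong : ∀ {F : Form (suc m) n} → Congruent F → ∀ x → Congruent (F ∘ (x ∷_))
  fix-first-cong F-cong x p = F-cong (∷-cong (λ _ → refl) p)

  alternating-resp : ∀ m {F G : Form m n} → (∀ M → F M ≈ G M) → IsAlternating m F → IsAlternating m G
  alternating-resp zero    F≈G _ = tt
  alternating-resp (suc m) F≈G (linear , vanishes , rest) =
    (λ a x y r → trans (sym (F≈G _)) (trans (linear a x y r) (+-cong (*-congˡ (F≈G _)) (F≈G _)))) ,
    (λ M i i≡0 p → trans (sym (F≈G M)) (vanishes M i i≡0 p)) ,
    (λ x → alternating-resp m (λ M → F≈G (x ∷ M)) (rest x))

  record IsLinearMap (T : Row n → Row k) : Set (c ⊔ ℓ) where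
    field
      cong   : ∀ {x y} → x ≋ y → T x ≋ T y
      linear : ∀ a x y → T (λ j → a * x j + y j) ≋ (λ j → a * T x j + T y j)

  -- Serves for three maps of rows: deleting a column, inserting a zero column, and multiplying by a
  -- matrix on the right.
  alternating-pullback : ∀ m {F : Form m k} → Congruent F → IsAlternating m F →
    {T : Row n → Row k} → IsLinearMap T → IsAlternating m (λ M → F (T ∘ M))
  alternating-pullback zero    F-cong _ _ = tt
  alternating-pullback (suc m) {F} F-cong (linear , vanishes , rest) {T} T-linear =
    (λ a x y r → begin
      F (T ∘ ((λ j → a * x j + y j) ∷ r))                ≈⟨ F-cong (∘-∷ T _ r) ⟩
      F (T (λ j → a * x j + y j) ∷ (T ∘ r))              ≈⟨ F-cong (∷-cong (T.linear a x y) (λ _ _ → refl)) ⟩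
      F ((λ j → a * T x j + T y j) ∷ (T ∘ r))            ≈⟨ linear a (T x) (T y) (T ∘ r) ⟩
      a * F (T x ∷ (T ∘ r)) + F (T y ∷ (T ∘ r))          ≈⟨ +-cong (*-congˡ (F-cong (∘-∷ T x r))) (F-cong (∘-∷ T y r)) ⟨
      a * F (T ∘ (x ∷ r)) + F (T ∘ (y ∷ r))              ∎) ,
    (λ M i i≡0 p → vanishes (T ∘ M) i i≡0 (T.cong p)) ,
    (λ x → alternating-resp m (λ M → sym (F-cong (∘-∷ T x M)))
             (alternating-pullback m (fix-first-cong F-cong (T x)) (rest (T x)) T-linear))
    where module T = IsLinearMap T-linear

  alternating-sum : ∀ m (a : Row k) {G : Fin k → Form m n} → (∀ j → IsAlternating m (G j)) →
    IsAlternating m (λ M → sum λ j → a j * G j M)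
  alternating-sum zero    a alt = tt
  alternating-sum (suc m) a {G} alt =
    (λ b x y r → begin
      (sum λ j → a j * G j ((λ k → b * x k + y k) ∷ r))
        ≈⟨ sum-cong-≋ (λ j → trans (*-congˡ (proj₁ (alt j) b x y r)) (lemma (a j) b _ _)) ⟩
      (sum λ j → b * (a j * G j (x ∷ r)) + a j * G j (y ∷ r))
        ≈⟨ ∑-distrib-+ (λ j → b * (a j * G j (x ∷ r))) (λ j → a j * G j (y ∷ r)) ⟩
      (sum λ j → b * (a j * G j (x ∷ r))) + (sum λ j → a j * G j (y ∷ r))
        ≈⟨ +-congʳ (*-distribˡ-sum b (λ j → a j * G j (x ∷ r))) ⟨
      b * (sum λ j → a j * G j (x ∷ r)) + (sum λ j → a j * G j (y ∷ r))
        ∎) ,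
    (λ M i i≡0 p → sum-zero (λ j → trans (*-congˡ (proj₁ (proj₂ (alt j)) M i i≡0 p)) (zeroʳ (a j)))) ,
    (λ x → alternating-sum m a (λ j → proj₂ (proj₂ (alt j)) x))
    where
    lemma : ∀ a b u v → a * (b * u + v) ≈ b * (a * u) + a * v
    lemma = S.solve 4 (λ a b u v → a :* (b :* u :+ v) := b :* (a :* u) :+ a :* v) refl

  -- Polarization: F vanishes with x + y in both of the first places, and so do the two diagonal
  -- terms of the expansion. The factors `1#` arise because additivity is the case a = 1 of
  -- `LinearInFirst`.
  swap-first-two : ∀ {F : Form (2 ℕ.+ m) n} → IsAlternating (2 ℕ.+ m) F → Congruent F →
    ∀ x y r → F (x ∷ y ∷ r) ≈ - F (y ∷ x ∷ r)
  swap-first-two {F = F} (linear , vanishes , rest) F-cong x y r = begin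
    F (x ∷ y ∷ r)
      ≈⟨ lemma (F (x ∷ x ∷ r)) (F (x ∷ y ∷ r)) (F (y ∷ x ∷ r)) (F (y ∷ y ∷ r)) ⟩
    ((1# * (1# * F (x ∷ x ∷ r) + F (x ∷ y ∷ r)) + (1# * F (y ∷ x ∷ r) + F (y ∷ y ∷ r))) +
      (- F (x ∷ x ∷ r) + - F (y ∷ y ∷ r))) + - F (y ∷ x ∷ r)
      ≈⟨ +-congʳ (+-cong (trans (sym expand) (vanishes _ zero ≡.refl (λ _ → refl)))
                         (+-cong (-‿cong (vanishes _ zero ≡.refl (λ _ → refl)))
                                 (-‿cong (vanishes _ zero ≡.refl (λ _ → refl))))) ⟩
    (0# + (- 0# + - 0#)) + - F (y ∷ x ∷ r)
      ≈⟨ S.solve 1 (λ a → (con (+ 0) :+ (:- con (+ 0) :+ :- con (+ 0))) :+ :- a := :- a) refl _ ⟩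
    - F (y ∷ x ∷ r) ∎
    where
    x+y : Row _
    x+y j = 1# * x j + y j
    expand : F (x+y ∷ x+y ∷ r) ≈
             1# * (1# * F (x ∷ x ∷ r) + F (x ∷ y ∷ r)) + (1# * F (y ∷ x ∷ r) + F (y ∷ y ∷ r))
    expand = trans (linear 1# x y _)
               (+-cong (*-congˡ (proj₁ (rest x) 1# x y r)) (proj₁ (rest y) 1# x y r))
    lemma : ∀ a b c d → b ≈ ((1# * (1# * a + b) + (1# * c + d)) + (- a + - d)) + - c
    lemma = S.solve 4 (λ a b c d → b := ((con (+ 1) :* (con (+ 1) :* a :+ b) :+ (con (+ 1) :* c :+ d)) :+ (:- a :+ :- d)) :+ :- c) refl

  -- The row after x is cleared by linearity in the second place. For the later rows x is swapped
  -- behind `r zero`; once `r zero` is fixed, x is again a first row and induction applies. A second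
  -- swap restores the sign.
  add-multiples-of-first : ∀ m {F : Form (suc m) n} → IsAlternating (suc m) F → Congruent F →
    ∀ x r (a : Vector Carrier m) → F (x ∷ (λ i j → a i * x j + r i j)) ≈ F (x ∷ r)
  add-multiples-of-first zero    alt F-cong x r a = F-cong (∷-cong (λ _ → refl) (λ ()))
  add-multiples-of-first (suc m) {F} alt@(_ , vanishes , rest) F-cong x r a = begin
    F (x ∷ r′)
      ≈⟨ F-cong (∷-cong (λ _ → refl) η) ⟩
    F (x ∷ (λ j → a zero * x j + r zero j) ∷ tail r′)
      ≈⟨ proj₁ (rest x) (a zero) x (r zero) (tail r′) ⟩
    a zero * F (x ∷ x ∷ tail r′) + F (x ∷ r zero ∷ tail r′)
      ≈⟨ +-congʳ (trans (*-congˡ (vanishes _ zero ≡.refl (λ _ → refl))) (zeroʳ _)) ⟩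
    0# + F (x ∷ r zero ∷ tail r′)
      ≈⟨ trans (+-identityˡ _) (swap-first-two alt F-cong x (r zero) (tail r′)) ⟩
    - F (r zero ∷ x ∷ tail r′)
      ≈⟨ -‿cong (add-multiples-of-first m (rest (r zero)) (fix-first-cong F-cong (r zero)) x (tail r) (tail a)) ⟩
    - F (r zero ∷ x ∷ tail r)
      ≈⟨ swap-first-two alt F-cong x (r zero) (tail r) ⟨
    F (x ∷ r zero ∷ tail r)
      ≈⟨ F-cong (∷-cong (λ _ → refl) η′) ⟩
    F (x ∷ r) ∎
    where
    r′ : Vector (Row _) (suc m)
    r′ i j = a i * x j + r i j
    η : ∀ i → r′ i ≋ ((λ j → a zero * x j + r zero j) ∷ tail r′) i
    η zero    j = refl
    η (suc i) j = refl
    η′ : ∀ i → (r zero ∷ tail r) i ≋ r i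
    η′ zero    j = refl
    η′ (suc i) j = refl

  sign : Fin n → Carrier
  sign j = (- 1#) ^ toℕ j

  -- Row j passes j others, and each adjacent swap costs a factor -1. This is the origin of the
  -- signs in the Laplace expansion.
  move-to-front : ∀ m {F : Form (suc m) n} → IsAlternating (suc m) F → Congruent F →
    ∀ u j → F (u j ∷ (u ∘ punchIn j)) ≈ sign j * F u
  move-to-front m {F} alt F-cong u zero = trans (F-cong η) (sym (*-identityˡ (F u)))
    where
    η : ∀ i → (u zero ∷ (u ∘ suc)) i ≋ u i
    η zero    j = refl
    η (suc i) j = refl
  move-to-front (suc m) {F} alt@(_ , _ , rest) F-cong u (suc j) = begin
    F (u (suc j) ∷ (u ∘ punchIn (suc j)))
      ≈⟨ F-cong (∷-cong (λ _ → refl) η) ⟩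
    F (u (suc j) ∷ u zero ∷ (u ∘ suc ∘ punchIn j))
      ≈⟨ swap-first-two alt F-cong _ _ _ ⟩
    - F (u zero ∷ u (suc j) ∷ (u ∘ suc ∘ punchIn j))
      ≈⟨ -‿cong (move-to-front m (rest (u zero)) (fix-first-cong F-cong (u zero)) (u ∘ suc) j) ⟩
    - (sign j * F (u zero ∷ (u ∘ suc)))
      ≈⟨ -‿cong (*-congˡ (F-cong η′)) ⟩
    - (sign j * F u)
      ≈⟨ S.solve 2 (λ s a → :- (s :* a) := (:- con (+ 1) :* s) :* a) refl (sign j) (F u) ⟩
    (- 1# * sign j) * F u ∎
    where
    η : ∀ i → (u ∘ punchIn (suc j)) i ≋ (u zero ∷ (u ∘ suc ∘ punchIn j)) i
    η zero    k = refl
    η (suc i) k = refl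
    η′ : ∀ i → (u zero ∷ (u ∘ suc)) i ≋ u i
    η′ zero    j = refl
    η′ (suc i) j = refl

  linear-sum : ∀ {F : Form (suc m) n} → Congruent F → LinearInFirst F →
    ∀ {k} (a : Row k) (X : Fin k → Row n) r →
    F ((λ j → sum λ i → a i * X i j) ∷ r) ≈ sum λ i → a i * F (X i ∷ r)
  linear-sum {F = F} F-cong linear {zero} a X r = begin
    -- The zero row is -1 times itself plus itself, so linearity gives F(0) = -F(0) + F(0).
    F (0ʳ ∷ r)                        ≈⟨ F-cong (∷-cong (λ _ → S.solve 0 (con (+ 0) := :- con (+ 1) :* con (+ 0) :+ con (+ 0)) refl) (λ _ _ → refl)) ⟩
    F ((λ j → - 1# * 0ʳ j + 0ʳ j) ∷ r) ≈⟨ linear (- 1#) 0ʳ 0ʳ r ⟩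
    - 1# * F (0ʳ ∷ r) + F (0ʳ ∷ r)    ≈⟨ S.solve 1 (λ a → :- con (+ 1) :* a :+ a := con (+ 0)) refl _ ⟩
    0# ∎
    where
    0ʳ : Row _
    0ʳ _ = 0#
  linear-sum {F = F} F-cong linear {suc k} a X r =
    trans (linear (a zero) (X zero) _ r) (+-congˡ (linear-sum {F = F} F-cong linear (tail a) (tail X) r))

  determinant-cong : ∀ n → Congruent (determinant n)
  determinant-cong zero    p = refl
  determinant-cong (suc n) p = sum-cong-≋ λ j →
    *-congˡ {sign j} (*-cong (p zero j) (determinant-cong n (λ i k → p (suc i) (punchIn j k))))

  -- The expansion of a determinant with equal first rows x along both of them:
  -- the terms for the pairs of columns (0, k+1) and (k+1, 0) cancel.
  double-expansion : ∀ n (x : Row (2 ℕ.+ n)) (H : (Fin n → Fin (2 ℕ.+ n)) → Carrier) →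
    (∀ {φ ψ} → φ ≗ ψ → H φ ≈ H ψ) →
    sum (λ j → sign j * (x j * sum λ k → sign k * (x (punchIn j k) * H (punchIn j ∘ punchIn k)))) ≈ 0#
  double-expansion n x H H-ext = begin
    1# * (x zero * sum (λ k → sign k * (x (suc k) * H (punchIn zero ∘ punchIn k)))) + sum outer
      ≈⟨ +-congʳ (trans (*-identityˡ _) (*-distribˡ-sum (x zero) (λ k → sign k * (x (suc k) * H (punchIn zero ∘ punchIn k))))) ⟩
    sum first + sum outer
      ≈⟨ ∑-distrib-+ first outer ⟨
    sum (λ j → first j + outer j)
      ≈⟨ sum-cong-≋ merge ⟩
    sum (λ j → sign j * (x (suc j) * sum (inner j)))
      ≈⟨ rest n x H H-ext ⟩
    0# ∎
    where
    first outer : Row (suc n)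
    first k = x zero * (sign k * (x (suc k) * H (punchIn zero ∘ punchIn k)))
    outer j = sign (suc j) * (x (suc j) * sum λ k → sign k * (x (punchIn (suc j) k) * H (punchIn (suc j) ∘ punchIn k)))
    inner : Fin (suc n) → Row n
    inner j k = sign k * (x (suc (punchIn j k)) * H (punchIn (suc j) ∘ punchIn (suc k)))
    same : ∀ j → H (punchIn zero ∘ punchIn j) ≈ H (punchIn (suc j) ∘ punchIn zero)
    same j = H-ext (λ _ → ≡.refl)
    merge : ∀ j → first j + outer j ≈ sign j * (x (suc j) * sum (inner j))
    merge j = begin
      first j + outer j
        ≈⟨ +-cong (*-congˡ (*-congˡ (*-congˡ (same j)))) (*-congˡ (*-congˡ (+-congˡ
             (trans (sum-cong-≋ {n} (λ k → *-assoc (- 1#) (sign k) (x (suc (punchIn j k)) * H (punchIn (suc j) ∘ punchIn (suc k))))) (sym (*-distribˡ-sum (- 1#) (inner j))))))) ⟩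
      x zero * (sign j * (x (suc j) * h)) + (- 1# * sign j) * (x (suc j) * (1# * (x zero * h) + - 1# * sum (inner j)))
        ≈⟨ S.solve 5 (λ x₀ s x₁ h i → x₀ :* (s :* (x₁ :* h)) :+ (:- con (+ 1) :* s) :* (x₁ :* (con (+ 1) :* (x₀ :* h) :+ :- con (+ 1) :* i)) := s :* (x₁ :* i)) refl (x zero) (sign j) (x (suc j)) h (sum (inner j)) ⟩
      sign j * (x (suc j) * sum (inner j)) ∎
      where h = H (punchIn (suc j) ∘ punchIn zero)
    -- The surviving terms take both columns among the positive ones. They form the same double sum
    -- with one column fewer, for `tail x` and `H ∘ lift 1`.
    rest : ∀ n (x : Row (2 ℕ.+ n)) (H : (Fin n → Fin (2 ℕ.+ n)) → Carrier) → (∀ {φ ψ} → φ ≗ ψ → H φ ≈ H ψ) →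
      sum (λ j → sign j * (x (suc j) * sum λ k → sign k * (x (suc (punchIn j k)) * H (punchIn (suc j) ∘ punchIn (suc k))))) ≈ 0#
    rest zero    x H H-ext = S.solve 2 (λ s x₁ → s :* (x₁ :* con (+ 0)) :+ con (+ 0) := con (+ 0)) refl _ (x (suc zero))
    rest (suc n) x H H-ext = begin
      sum (λ j → sign j * (x (suc j) * sum λ k → sign k * (x (suc (punchIn j k)) * H (punchIn (suc j) ∘ punchIn (suc k)))))
        ≈⟨ sum-cong-≋ (λ j → *-congˡ {sign j} (*-congˡ {x (suc j)} (sum-cong-≋ (λ k → *-congˡ {sign k} (*-congˡ {x (suc (punchIn j k))} (H-ext (lifted j k))))))) ⟩
      sum (λ j → sign j * (x (suc j) * sum λ k → sign k * (x (suc (punchIn j k)) * H (lift 1 (punchIn j ∘ punchIn k)))))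
        ≈⟨ double-expansion n (tail x) (H ∘ lift 1) (λ φ≗ψ → H-ext λ { zero → ≡.refl ; (suc i) → ≡.cong suc (φ≗ψ i) }) ⟩
      0# ∎
      where
      lifted : ∀ j k → (punchIn (suc j) ∘ punchIn (suc k)) ≗ lift 1 (punchIn j ∘ punchIn k)
      lifted j k zero    = ≡.refl
      lifted j k (suc i) = ≡.refl

  -- For equal first rows, expanding along both gives a `double-expansion` whose H is the
  -- complementary minor. With the first row fixed, the expansion is a combination with constant
  -- coefficients of smaller determinants, each pulled back along the deletion of a column.
  determinant-alternating : ∀ n → IsAlternating n (determinant n)
  determinant-alternating zero    = tt
  determinant-alternating (suc n) = linear , vanishes n , rest
    where
    minor : Vector (Row (suc n)) n → Fin (suc n) → Carrier
    minor r j = determinant n (λ i k → r i (punchIn j k))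
    linear : LinearInFirst (determinant (suc n))
    linear a x y r = begin
      (sum λ j → sign j * ((a * x j + y j) * minor r j))
        ≈⟨ sum-cong-≋ (λ j → distribute (sign j) a (x j) (y j) (minor r j)) ⟩
      (sum λ j → a * (sign j * (x j * minor r j)) + sign j * (y j * minor r j))
        ≈⟨ ∑-distrib-+ (λ j → a * (sign j * (x j * minor r j))) (λ j → sign j * (y j * minor r j)) ⟩
      (sum λ j → a * (sign j * (x j * minor r j))) + (sum λ j → sign j * (y j * minor r j))
        ≈⟨ +-congʳ (*-distribˡ-sum a (λ j → sign j * (x j * minor r j))) ⟨
      a * (sum λ j → sign j * (x j * minor r j)) + (sum λ j → sign j * (y j * minor r j)) ∎
      where
      distribute : ∀ s a x y d → s * ((a * x + y) * d) ≈ a * (s * (x * d)) + s * (y * d)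
      distribute = S.solve 5 (λ s a x y d → s :* ((a :* x :+ y) :* d) := a :* (s :* (x :* d)) :+ s :* (y :* d)) refl
    vanishes : ∀ n → VanishesOnFirstTwo (determinant (suc n))
    vanishes (suc n) M zero _ p = trans
      (sum-cong-≋ (λ j → *-congˡ {sign j} (*-congˡ {M zero j} (sum-cong-≋ (λ k → *-congˡ {sign k} (*-congʳ {determinant n (λ i l → M (suc (suc i)) (punchIn j (punchIn k l)))} (sym (p (punchIn j k)))))))))
      (double-expansion n (M zero) (λ φ → determinant n (λ i l → M (suc (suc i)) (φ l)))
        (λ φ≗ψ → determinant-cong n (λ i l → reflexive (≡.cong (M (suc (suc i))) (φ≗ψ l)))))
    rest : ∀ x → IsAlternating n (λ r → determinant (suc n) (x ∷ r))
    rest x = alternating-resp n (λ r → sum-cong-≋ (λ j → *-assoc (sign j) (x j) (minor r j)))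
      (alternating-sum n (λ j → sign j * x j) (λ j →
        alternating-pullback n (determinant-cong n) (determinant-alternating n)
          {T = _∘ punchIn j} (record { cong = λ p k → p (punchIn j k) ; linear = λ _ _ _ _ → refl })))

  -- A section of the column deletion `_∘ punchIn j`. Deleting column j and then padding amounts to
  -- clearing that column, which a multiple of `unit j` can do.
  pad : Fin (suc n) → Row n → Row (suc n)
  pad zero    x zero    = 0#
  pad zero    x (suc k) = x k
  pad {suc n} (suc j) x zero    = x zero
  pad {suc n} (suc j) x (suc k) = pad j (tail x) k

  pad-linear : ∀ (j : Fin (suc n)) → IsLinearMap (pad j)
  pad-linear j = record { cong = cong j ; linear = linear j }
    where
    cong : ∀ {n} (j : Fin (suc n)) {x y : Row n} → x ≋ y → pad j x ≋ pad j y
    cong zero p zero    = refl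
    cong zero p (suc k) = p k
    cong {suc n} (suc j) p zero    = p zero
    cong {suc n} (suc j) p (suc k) = cong j (p ∘ suc) k
    linear : ∀ {n} (j : Fin (suc n)) a (x y : Row n) → pad j (λ k → a * x k + y k) ≋ (λ k → a * pad j x k + pad j y k)
    linear zero a x y zero    = S.solve 1 (λ a → con (+ 0) := a :* con (+ 0) :+ con (+ 0)) refl a
    linear zero a x y (suc k) = refl
    linear {suc n} (suc j) a x y zero    = refl
    linear {suc n} (suc j) a x y (suc k) = linear j a (tail x) (tail y) k

  pad-unit : ∀ (j : Fin (suc n)) i → pad j (unit i) ≋ unit (punchIn j i)
  pad-unit zero    i       zero    = refl
  pad-unit zero    i       (suc k) = refl
  pad-unit {suc n} (suc j) zero    zero    = refl
  pad-unit {suc n} (suc j) zero    (suc k) = zero-row j k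
    where
    zero-row : ∀ {n} (j : Fin (suc n)) → pad j (λ _ → 0#) ≋ (λ _ → 0#)
    zero-row zero zero    = refl
    zero-row zero (suc k) = refl
    zero-row {suc n} (suc j) zero    = refl
    zero-row {suc n} (suc j) (suc k) = zero-row j k
  pad-unit {suc n} (suc j) (suc i) zero    = refl
  pad-unit {suc n} (suc j) (suc i) (suc k) = pad-unit j i k

  clear-column : ∀ (j : Fin (suc n)) x → (λ k → - x j * unit j k + x k) ≋ pad j (x ∘ punchIn j)
  clear-column zero x zero    = S.solve 1 (λ a → :- a :* con (+ 1) :+ a := con (+ 0)) refl (x zero)
  clear-column zero x (suc k) = S.solve 2 (λ a b → :- a :* con (+ 0) :+ b := b) refl (x zero) (x (suc k))
  clear-column {suc n} (suc j) x zero    = S.solve 2 (λ a b → :- a :* con (+ 0) :+ b := b) refl (x (suc j)) (x zero)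
  clear-column {suc n} (suc j) x (suc k) = clear-column j (tail x) k

  -- The first row is expanded into unit rows. Multiples of `unit j` then clear column j of the
  -- other rows, leaving a form of smaller size evaluated through `pad j`. By induction it is a
  -- multiple of the minor, and `move-to-front` identifies the factor.
  alternating-unique : ∀ n {F : Form n n} → Congruent F → IsAlternating n F →
    ∀ M → F M ≈ F unit * determinant n M
  alternating-unique zero    F-cong alt M = trans (F-cong (λ ())) (sym (*-identityʳ _))
  alternating-unique (suc n) {F} F-cong alt@(linear , _ , rest) M = begin
    F M
      ≈⟨ F-cong η ⟩
    F ((λ k → sum λ j → M zero j * unit j k) ∷ tail M)
      ≈⟨ linear-sum {F = F} F-cong linear (M zero) unit (tail M) ⟩
    (sum λ j → M zero j * F (unit j ∷ tail M))
      ≈⟨ sum-cong-≋ (λ j → trans (*-congˡ (minor j)) (rearrange (M zero j) (sign j) (F unit) _)) ⟩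
    (sum λ j → F unit * (sign j * (M zero j * determinant n (λ i k → M (suc i) (punchIn j k)))))
      ≈⟨ *-distribˡ-sum (F unit) (λ j → sign j * (M zero j * determinant n (λ i k → M (suc i) (punchIn j k)))) ⟨
    F unit * determinant (suc n) M ∎
    where
    rearrange : ∀ a s f d → a * ((s * f) * d) ≈ f * (s * (a * d))
    rearrange = S.solve 4 (λ a s f d → a :* ((s :* f) :* d) := f :* (s :* (a :* d))) refl
    η : ∀ i → M i ≋ ((λ k → sum λ j → M zero j * unit j k) ∷ tail M) i
    η zero    k = sym (sum-unit (M zero) k)
    η (suc i) k = refl
    minor : ∀ j → F (unit j ∷ tail M) ≈ (sign j * F unit) * determinant n (λ i k → M (suc i) (punchIn j k))
    minor j = begin
      F (unit j ∷ tail M)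
        ≈⟨ add-multiples-of-first n alt F-cong (unit j) (tail M) (λ i → - M (suc i) j) ⟨
      F (unit j ∷ (λ i k → - M (suc i) j * unit j k + M (suc i) k))
        ≈⟨ F-cong (∷-cong (λ _ → refl) (λ i → clear-column j (M (suc i)))) ⟩
      F (unit j ∷ (λ i → pad j (M (suc i) ∘ punchIn j)))
        ≈⟨ alternating-unique n
             (λ p → F-cong (∷-cong (λ _ → refl) (λ i → IsLinearMap.cong (pad-linear j) (p i))))
             (alternating-pullback n (fix-first-cong F-cong (unit j)) (rest (unit j)) (pad-linear j))
             (λ i → M (suc i) ∘ punchIn j) ⟩
      F (unit j ∷ (pad j ∘ unit)) * determinant n (λ i k → M (suc i) (punchIn j k))
        ≈⟨ *-congʳ (trans (F-cong (∷-cong (λ _ → refl) (pad-unit j))) (move-to-front n alt F-cong unit j)) ⟩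
      (sign j * F unit) * determinant n (λ i k → M (suc i) (punchIn j k)) ∎

  infixl 7 _⊗_
  _⊗_ : SquareMatrix n → SquareMatrix n → SquareMatrix n
  (A ⊗ B) i k = sum λ j → A i j * B j k

  -- Multiplication by B acts on each row of A separately, so the left side is alternating in the
  -- rows of A. Its value on the unit rows is the determinant of B.
  determinant-⊗ : ∀ n (A B : SquareMatrix n) → determinant n (A ⊗ B) ≈ determinant n A * determinant n B
  determinant-⊗ n A B = begin
    determinant n (A ⊗ B)
      ≈⟨ alternating-unique n (λ p → determinant-cong n (λ i → T.cong (p i)))
           (alternating-pullback n (determinant-cong n) (determinant-alternating n) T-linear) A ⟩
    determinant n (unit ⊗ B) * determinant n A
      ≈⟨ *-comm _ _ ⟩
    determinant n A * determinant n (unit ⊗ B)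
      ≈⟨ *-congˡ (determinant-cong n (λ i k → sum-unitˡ (λ j → B j k) i)) ⟩
    determinant n A * determinant n B ∎
    where
    T-linear : IsLinearMap (λ x k → sum λ j → x j * B j k)
    T-linear = record
      { cong   = λ p k → sum-cong-≋ (λ j → *-congʳ (p j))
      ; linear = λ a x y k → trans
          (sum-cong-≋ (λ j → S.solve 4 (λ a x y b → (a :* x :+ y) :* b := a :* (x :* b) :+ y :* b) refl a (x j) (y j) (B j k)))
          (trans (∑-distrib-+ (λ j → a * (x j * B j k)) (λ j → y j * B j k))
                 (+-congʳ (sym (*-distribˡ-sum a (λ j → x j * B j k)))))
      }
    module T = IsLinearMap T-linear

  determinant-first-row : ∀ n (M : SquareMatrix (suc n)) → (∀ j → M zero (suc j) ≈ 0#) →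
    determinant (suc n) M ≈ M zero zero * determinant n (λ i k → M (suc i) (suc k))
  determinant-first-row n M p = begin
    1# * (M zero zero * d) + sum (λ j → sign (suc j) * (M zero (suc j) * determinant n (λ i k → M (suc i) (punchIn (suc j) k))))
      ≈⟨ +-cong (*-identityˡ _) (sum-zero (λ j → trans (*-congˡ (trans (*-congʳ (p j)) (zeroˡ _))) (zeroʳ _))) ⟩
    M zero zero * d + 0#
      ≈⟨ +-identityʳ _ ⟩
    M zero zero * d ∎
    where d = determinant n (λ i k → M (suc i) (suc k))

  determinant-unit : ∀ n → determinant n unit ≈ 1#
  determinant-unit zero    = refl
  determinant-unit (suc n) = trans (determinant-first-row n unit (λ _ → refl)) (trans (*-identityˡ _) (determinant-unit n))

  -- The zero block is the one found in the matrix of a rotation when the last basis vectors span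
  -- its fixed space.
  determinant-first-two-rows : ∀ n (M : SquareMatrix (2 ℕ.+ n)) →
    (∀ j → M zero (suc (suc j)) ≈ 0#) → (∀ j → M (suc zero) (suc (suc j)) ≈ 0#) →
    determinant (2 ℕ.+ n) M ≈
      (M zero zero * M (suc zero) (suc zero) + - (M zero (suc zero) * M (suc zero) zero)) *
      determinant n (λ i k → M (suc (suc i)) (suc (suc k)))
  determinant-first-two-rows n M p q = begin
    1# * (M zero zero * determinant (suc n) M₀) + ((- 1# * 1#) * (M zero (suc zero) * determinant (suc n) M₁) +
      sum (λ j → sign (suc (suc j)) * (M zero (suc (suc j)) * determinant (suc n) (λ i k → M (suc i) (punchIn (suc (suc j)) k)))))
      ≈⟨ +-cong (*-congˡ (*-congˡ (determinant-first-row n M₀ q)))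
           (+-cong (*-congˡ (*-congˡ (determinant-first-row n M₁ q)))
             (sum-zero (λ j → trans (*-congˡ {sign (suc (suc j))} (trans (*-congʳ (p j)) (zeroˡ _))) (zeroʳ _)))) ⟩
    1# * (M zero zero * (M (suc zero) (suc zero) * d)) + ((- 1# * 1#) * (M zero (suc zero) * (M (suc zero) zero * d)) + 0#)
      ≈⟨ S.solve 5 (λ a b a′ b′ d → con (+ 1) :* (a :* (b′ :* d)) :+ ((:- con (+ 1) :* con (+ 1)) :* (b :* (a′ :* d)) :+ con (+ 0)) :=
           (a :* b′ :+ :- (b :* a′)) :* d) refl (M zero zero) (M zero (suc zero)) (M (suc zero) zero) (M (suc zero) (suc zero)) d ⟩
    (M zero zero * M (suc zero) (suc zero) + - (M zero (suc zero) * M (suc zero) zero)) * d ∎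
    where
    d = determinant n (λ i k → M (suc (suc i)) (suc (suc k)))
    M₀ M₁ : SquareMatrix (suc n)
    M₀ i k = M (suc i) (suc k)
    M₁ i k = M (suc i) (punchIn (suc zero) k)

-- Positivity, roots of unity and recurrences in an ordered field

module RealFieldProperties (ℝ : RealField c ℓ₁ ℓ₂) where
  open RealField ℝ hiding (zero)
  open IsStrictTotalOrder isStrictTotalOrder public using (_≟_)
  open IsStrictTotalOrder isStrictTotalOrder using (compare; irrefl; <-respʳ-≈; <-respˡ-≈) renaming (trans to <-trans)
  open RawSemiringDefinitions (Semiring.rawSemiring semiring) using (_^_)
  open SetoidReasoning setoid
  private
    module S = IntegerSolver commutativeRing
  open S using (_:+_; _:*_; :-_; _:=_; con)

  *-cancel-0 : ∀ {x y} → ¬ x ≈ 0# → x * y ≈ 0# → y ≈ 0#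
  *-cancel-0 {x} {y} x≉0 xy≈0 with inverse x x≉0
  ... | z , xz≈1 = begin
    y             ≈⟨ *-identityˡ y ⟨
    1# * y        ≈⟨ *-congʳ xz≈1 ⟨
    (x * z) * y   ≈⟨ S.solve 3 (λ x z y → (x :* z) :* y := z :* (x :* y)) refl x z y ⟩
    z * (x * y)   ≈⟨ *-congˡ xy≈0 ⟩
    z * 0#        ≈⟨ zeroʳ z ⟩
    0#            ∎

  x-y≈0⇒x≈y : ∀ {x y} → x + - y ≈ 0# → x ≈ y
  x-y≈0⇒x≈y {x} {y} p = begin
    x               ≈⟨ S.solve 2 (λ x y → x := (x :+ :- y) :+ y) refl x y ⟩
    (x + - y) + y   ≈⟨ +-congʳ p ⟩
    0# + y          ≈⟨ +-identityˡ y ⟩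
    y               ∎

  x≈y⇒x-y≈0 : ∀ {x y} → x ≈ y → x + - y ≈ 0#
  x≈y⇒x-y≈0 {x} {y} p = trans (+-congʳ p) (-‿inverseʳ y)

  pos⇒≉0 : ∀ {x} → 0# < x → ¬ x ≈ 0#
  pos⇒≉0 0<x x≈0 = irrefl (sym x≈0) 0<x

  +-pos : ∀ {x y} → 0# < x → 0# < y → 0# < x + y
  +-pos {x} {y} 0<x 0<y = <-trans 0<y (<-respˡ-≈ (+-identityˡ y) (+-monoˡ-< y 0<x))

  -- A disjunction, unlike the negation `_≤_`, so that proofs can split on it.
  NonNegative : Carrier → Set (ℓ₁ ⊔ ℓ₂)
  NonNegative x = 0# < x ⊎ x ≈ 0#

  pos+nonneg : ∀ {x y} → 0# < x → NonNegative y → 0# < x + y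
  pos+nonneg 0<x (inj₁ 0<y) = +-pos 0<x 0<y
  pos+nonneg 0<x (inj₂ y≈0) = <-respʳ-≈ (sym (trans (+-congˡ y≈0) (+-identityʳ _))) 0<x

  +-nonneg : ∀ {x y} → NonNegative x → NonNegative y → NonNegative (x + y)
  +-nonneg (inj₁ 0<x) 0≤y = inj₁ (pos+nonneg 0<x 0≤y)
  +-nonneg (inj₂ x≈0) (inj₁ 0<y) = inj₁ (<-respʳ-≈ (sym (trans (+-congʳ x≈0) (+-identityˡ _))) 0<y)
  +-nonneg (inj₂ x≈0) (inj₂ y≈0) = inj₂ (trans (+-cong x≈0 y≈0) (+-identityˡ 0#))

  *-pos-nonneg : ∀ {x y} → NonNegative x → 0# < y → NonNegative (x * y)
  *-pos-nonneg (inj₁ 0<x) 0<y = inj₁ (*-pos 0<x 0<y)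
  *-pos-nonneg (inj₂ x≈0) 0<y = inj₂ (trans (*-congʳ x≈0) (zeroˡ _))

  square-nonneg : ∀ x → NonNegative (x * x)
  square-nonneg x with compare 0# x
  ... | tri< 0<x _ _ = inj₁ (*-pos 0<x 0<x)
  ... | tri≈ _ 0≈x _ = inj₂ (trans (*-congʳ (sym 0≈x)) (zeroˡ x))
  ... | tri> _ _ x<0 = inj₁ (<-respʳ-≈ (S.solve 1 (λ x → :- x :* :- x := x :* x) refl x) (*-pos 0<-x 0<-x))
    where
    0<-x : 0# < - x
    0<-x = <-respˡ-≈ (-‿inverseʳ x) (<-respʳ-≈ (+-identityˡ (- x)) (+-monoˡ-< (- x) x<0))

  nonneg-sum-0 : ∀ {x y} → NonNegative x → NonNegative y → x + y ≈ 0# → x ≈ 0#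
  nonneg-sum-0 (inj₁ 0<x) 0≤y x+y≈0 = ⊥-elim (pos⇒≉0 (pos+nonneg 0<x 0≤y) x+y≈0)
  nonneg-sum-0 (inj₂ x≈0) _   _     = x≈0

  square-0 : ∀ {x} → x * x ≈ 0# → x ≈ 0#
  square-0 {x} xx≈0 with x ≟ 0#
  ... | yes x≈0 = x≈0
  ... | no  x≉0 = *-cancel-0 x≉0 xx≈0

  1≉0 : ¬ 1# ≈ 0#
  1≉0 = pos⇒≉0 0<1

  2# : Carrier
  2# = 1# + 1#

  2≉0 : ¬ 2# ≈ 0#
  2≉0 = pos⇒≉0 (+-pos 0<1 0<1)

  1≉-1 : ¬ 1# ≈ - 1#
  1≉-1 p = 2≉0 (trans (+-congʳ p) (-‿inverseˡ 1#))

  fromℕ : ℕ → Carrier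
  fromℕ zero    = 0#
  fromℕ (suc k) = 1# + fromℕ k

  fromℕ-nonneg : ∀ k → NonNegative (fromℕ k)
  fromℕ-nonneg zero    = inj₂ refl
  fromℕ-nonneg (suc k) = inj₁ (pos+nonneg 0<1 (fromℕ-nonneg k))

  fromℕ-suc≉0 : ∀ k → ¬ fromℕ (suc k) ≈ 0#
  fromℕ-suc≉0 k = pos⇒≉0 (pos+nonneg 0<1 (fromℕ-nonneg k))

  private
    -- x^(k+1) - 1 = (x - 1)(1 + x + ... + x^k)
    geometric : Carrier → ℕ → Carrier
    geometric x zero    = 1#
    geometric x (suc k) = 1# + x * geometric x k

    geometric-pos : ∀ {x} → NonNegative x → ∀ k → 0# < geometric x k
    geometric-pos 0≤x zero    = 0<1
    geometric-pos 0≤x (suc k) = pos+nonneg 0<1 (*-pos-nonneg 0≤x (geometric-pos 0≤x k))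

    geometric-factor : ∀ x k → x ^ suc k + - 1# ≈ geometric x k * (x + - 1#)
    geometric-factor x zero    = S.solve 1 (λ x → x :* con (+ 1) :+ :- con (+ 1) := con (+ 1) :* (x :+ :- con (+ 1))) refl x
    geometric-factor x (suc k) = begin
      x * x ^ suc k + - 1#
        ≈⟨ S.solve 2 (λ x p → x :* p :+ :- con (+ 1) := x :* (p :+ :- con (+ 1)) :+ (x :+ :- con (+ 1))) refl x (x ^ suc k) ⟩
      x * (x ^ suc k + - 1#) + (x + - 1#)
        ≈⟨ +-congʳ (*-congˡ (geometric-factor x k)) ⟩
      x * (geometric x k * (x + - 1#)) + (x + - 1#)
        ≈⟨ S.solve 2 (λ x g → x :* (g :* (x :+ :- con (+ 1))) :+ (x :+ :- con (+ 1)) := (con (+ 1) :+ x :* g) :* (x :+ :- con (+ 1))) refl x (geometric x k) ⟩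
      (1# + x * geometric x k) * (x + - 1#) ∎

    square-^ : ∀ x k → (x * x) ^ k ≈ x ^ k * x ^ k
    square-^ x zero    = sym (*-identityˡ 1#)
    square-^ x (suc k) = trans (*-congˡ (square-^ x k))
      (S.solve 2 (λ x p → (x :* x) :* (p :* p) := (x :* p) :* (x :* p)) refl x (x ^ k))

  -- Since x may be negative, the factorization is applied to x²: its geometric factor is positive
  -- and can be cancelled, which leaves x² = 1.
  root-of-unity : ∀ x k → x ^ suc k ≈ 1# → x ≈ 1# ⊎ x ≈ - 1#
  root-of-unity x k xᵏ≈1 with x ≟ 1#
  ... | yes x≈1 = inj₁ x≈1
  ... | no  x≉1 = inj₂ (x-y≈0⇒x≈y (*-cancel-0 (λ p → x≉1 (x-y≈0⇒x≈y p)) (begin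
    (x + - 1#) * (x + - - 1#)  ≈⟨ S.solve 1 (λ x → (x :+ :- con (+ 1)) :* (x :+ :- :- con (+ 1)) := x :* x :+ :- con (+ 1)) refl x ⟩
    x * x + - 1#               ≈⟨ x²-1≈0 ⟩
    0#                         ∎)))
    where
    x²-1≈0 : x * x + - 1# ≈ 0#
    x²-1≈0 = *-cancel-0 (pos⇒≉0 (geometric-pos (square-nonneg x) k)) (begin
      geometric (x * x) k * (x * x + - 1#)  ≈⟨ geometric-factor (x * x) k ⟨
      (x * x) ^ suc k + - 1#                ≈⟨ +-congʳ (trans (square-^ x (suc k)) (*-cong xᵏ≈1 xᵏ≈1)) ⟩
      1# * 1# + - 1#                        ≈⟨ S.solve 0 (con (+ 1) :* con (+ 1) :+ :- con (+ 1) := con (+ 0)) refl ⟩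
      0#                                    ∎)

  -- For a recurrence y = t x₁ + x₀ the quantity t x₀ x₁ grows by (t x₁)² at each
  -- step, so on a periodic solution all increments vanish.
  periodic-recurrence : ∀ t (x : ℕ → Carrier) → (∀ k → x (2 ℕ.+ k) ≈ t * x (suc k) + x k) →
    ∀ k → x (suc k) ≈ x 0 → x (2 ℕ.+ k) ≈ x 1 → t * x 1 ≈ 0#
  periodic-recurrence t x recurrence k per₀ per₁ = square-0 (nonneg-sum-0 (square-nonneg _) (proj₁ (proj₂ (growth k))) (begin
    (t * x 1) * (t * x 1) + excess k
      ≈⟨ S.solve 2 (λ a e → a := (e :+ a) :+ :- e) refl _ (energy 0) ⟩
    (energy 0 + ((t * x 1) * (t * x 1) + excess k)) + - energy 0
      ≈⟨ +-congʳ (proj₂ (proj₂ (growth k))) ⟨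
    energy (suc k) + - energy 0
      ≈⟨ +-congʳ (*-congˡ (*-cong per₀ per₁)) ⟩
    energy 0 + - energy 0
      ≈⟨ -‿inverseʳ _ ⟩
    0# ∎))
    where
    energy : ℕ → Carrier
    energy k = t * (x k * x (suc k))
    step : ∀ k → energy (suc k) ≈ energy k + (t * x (suc k)) * (t * x (suc k))
    step k = trans (*-congˡ (*-congˡ (recurrence k)))
      (S.solve 3 (λ t a b → t :* (b :* (t :* b :+ a)) := t :* (a :* b) :+ (t :* b) :* (t :* b)) refl t (x k) (x (suc k)))
    -- The first increment is kept apart from the sum e of the later ones, because it is the one
    -- shown to vanish.
    growth : ∀ k → ∃[ e ] NonNegative e × energy (suc k) ≈ energy 0 + ((t * x 1) * (t * x 1) + e)
    growth zero    = 0# , inj₂ refl , trans (step 0) (+-congˡ (sym (+-identityʳ _)))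
    growth (suc k) with growth k
    ... | e , 0≤e , p = e + (t * x (2 ℕ.+ k)) * (t * x (2 ℕ.+ k)) , +-nonneg 0≤e (square-nonneg _) ,
      trans (step (suc k)) (trans (+-congʳ p)
        (S.solve 4 (λ a b e f → (a :+ (b :+ e)) :+ f := a :+ (b :+ (e :+ f))) refl _ _ e _))
    excess : ℕ → Carrier
    excess k = proj₁ (growth k)

-- Linear combinations and linear functionals

module LinearCombinations {R : CommutativeRing c ℓ} (V : Module R μ ℓμ) where
  open CommutativeRing R hiding (zero)
  open Module V
  open Dimension V public
  open SemiringSum semiring using (sum)
  open CommutativeMonoidSum +ᴹ-commutativeMonoid using ()
    renaming (sum-cong-≋ to sumᴹ-cong; sum-remove to sumᴹ-remove; ∑-distrib-+ to sumᴹ-+; sum-replicate-zero to sumᴹ-zero)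
  open SetoidReasoning ≈ᴹ-setoid
  private
    module S = IntegerSolver R
    module D = Determinants R

  lc-cong : ∀ {n} {a a′ : Vector Carrier n} {b b′ : Vector Carrierᴹ n} →
    (∀ i → a i ≈ a′ i) → (∀ i → b i ≈ᴹ b′ i) → linearCombination a b ≈ᴹ linearCombination a′ b′
  lc-cong p q = sumᴹ-cong (λ i → *ₗ-cong (p i) (q i))

  lc-congˡ : ∀ {n} {a a′ : Vector Carrier n} (b : Vector Carrierᴹ n) →
    (∀ i → a i ≈ a′ i) → linearCombination a b ≈ᴹ linearCombination a′ b
  lc-congˡ b p = lc-cong p (λ i → ≈ᴹ-refl {b i})

  lc-zero : ∀ {n} {a : Vector Carrier n} (b : Vector Carrierᴹ n) → (∀ i → a i ≈ 0#) → linearCombination a b ≈ᴹ 0ᴹ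
  lc-zero {n} b p = ≈ᴹ-trans (sumᴹ-cong (λ i → ≈ᴹ-trans (*ₗ-congʳ (p i)) (*ₗ-zeroˡ (b i)))) (sumᴹ-zero n)

  lc-+ : ∀ {n} (a a′ : Vector Carrier n) b →
    linearCombination (λ i → a i + a′ i) b ≈ᴹ linearCombination a b +ᴹ linearCombination a′ b
  lc-+ a a′ b = ≈ᴹ-trans (sumᴹ-cong (λ i → *ₗ-distribʳ (b i) (a i) (a′ i))) (sumᴹ-+ (λ i → a i *ₗ b i) (λ i → a′ i *ₗ b i))

  lc-* : ∀ {n} t (a : Vector Carrier n) b → linearCombination (λ i → t * a i) b ≈ᴹ t *ₗ linearCombination a b
  lc-* {zero}  t a b = ≈ᴹ-sym (*ₗ-zeroʳ t)
  lc-* {suc n} t a b = ≈ᴹ-trans (+ᴹ-cong (*ₗ-assoc t (a zero) (b zero)) (lc-* t (tail a) (tail b))) (≈ᴹ-sym (*ₗ-distribˡ t _ _))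

  lc-remove : ∀ {n} (a : Vector Carrier (suc n)) b i →
    linearCombination a b ≈ᴹ a i *ₗ b i +ᴹ linearCombination (removeAt a i) (removeAt b i)
  lc-remove a b i = sumᴹ-remove {i = i} (λ j → a j *ₗ b j)

  lc-unit : ∀ {n} (b : Vector Carrierᴹ n) i → linearCombination (D.unit i) b ≈ᴹ b i
  lc-unit b zero = ≈ᴹ-trans (+ᴹ-cong (*ₗ-identityˡ _) (lc-zero (tail b) (λ _ → refl))) (+ᴹ-identityʳ _)
  lc-unit b (suc i) = ≈ᴹ-trans (+ᴹ-cong (*ₗ-zeroˡ _) (lc-unit (tail b) i)) (+ᴹ-identityˡ _)

  -- An equation between linear expressions in vectors is decided by comparing, with
  -- the ring solver, the coefficients of each vector on the two sides.
  module ModuleSolver where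
    open S using (Polynomial; var; con; _:+_; _:*_; :-_)

    infixr 7 _⊛_
    infixl 6 _⊕_
    infix  8 ⊝_

    data Expr (p q : ℕ) : Set where
      vec : Fin q → Expr p q
      𝟘   : Expr p q
      _⊕_ : Expr p q → Expr p q → Expr p q
      ⊝_  : Expr p q → Expr p q
      _⊛_ : Polynomial p → Expr p q → Expr p q

    ⟦_⟧ᴹ : ∀ {p q} → Expr p q → Vec Carrier p → Vec Carrierᴹ q → Carrierᴹ
    ⟦ vec i ⟧ᴹ ρ σ = lookup σ i
    ⟦ 𝟘 ⟧ᴹ     ρ σ = 0ᴹ
    ⟦ e ⊕ f ⟧ᴹ ρ σ = ⟦ e ⟧ᴹ ρ σ +ᴹ ⟦ f ⟧ᴹ ρ σ
    ⟦ ⊝ e ⟧ᴹ   ρ σ = -ᴹ ⟦ e ⟧ᴹ ρ σ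
    ⟦ a ⊛ e ⟧ᴹ ρ σ = S.⟦ a ⟧ ρ *ₗ ⟦ e ⟧ᴹ ρ σ

    private
      unitᵖ : ∀ {p q} → Fin q → Fin q → Polynomial p
      unitᵖ zero    zero    = con (+ 1)
      unitᵖ zero    (suc _) = con (+ 0)
      unitᵖ (suc _) zero    = con (+ 0)
      unitᵖ (suc i) (suc j) = unitᵖ i j

      unitᵖ-correct : ∀ {p q} (i j : Fin q) ρ → S.⟦ unitᵖ {p} i j ⟧ ρ ≈ D.unit i j
      unitᵖ-correct zero    zero    ρ = refl
      unitᵖ-correct zero    (suc _) ρ = refl
      unitᵖ-correct (suc _) zero    ρ = refl
      unitᵖ-correct (suc i) (suc j) ρ = unitᵖ-correct i j ρ

      coefficient : ∀ {p q} → Expr p q → Fin q → Polynomial p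
      coefficient (vec i) j = unitᵖ i j
      coefficient 𝟘       j = con (+ 0)
      coefficient (e ⊕ f) j = coefficient e j :+ coefficient f j
      coefficient (⊝ e)   j = con -[1+ 0 ] :* coefficient e j
      coefficient (a ⊛ e) j = a :* coefficient e j

      -1*ₗ : ∀ v → - 1# *ₗ v ≈ᴹ -ᴹ v
      -1*ₗ v = uniqueʳ‿-ᴹ v (- 1# *ₗ v) (begin
        v +ᴹ - 1# *ₗ v          ≈⟨ +ᴹ-congʳ (*ₗ-identityˡ v) ⟨
        1# *ₗ v +ᴹ - 1# *ₗ v    ≈⟨ *ₗ-distribʳ v 1# (- 1#) ⟨
        (1# + - 1#) *ₗ v        ≈⟨ *ₗ-congʳ (-‿inverseʳ 1#) ⟩
        0# *ₗ v                 ≈⟨ *ₗ-zeroˡ v ⟩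
        0ᴹ                      ∎)

      expand : ∀ {p q} (e : Expr p q) ρ σ → linearCombination (λ j → S.⟦ coefficient e j ⟧ ρ) (lookup σ) ≈ᴹ ⟦ e ⟧ᴹ ρ σ
      expand (vec i) ρ σ = ≈ᴹ-trans (lc-congˡ (lookup σ) (λ j → unitᵖ-correct i j ρ)) (lc-unit (lookup σ) i)
      expand 𝟘       ρ σ = lc-zero (lookup σ) (λ _ → refl)
      expand (e ⊕ f) ρ σ = ≈ᴹ-trans (lc-+ _ _ (lookup σ)) (+ᴹ-cong (expand e ρ σ) (expand f ρ σ))
      expand (⊝ e)   ρ σ = ≈ᴹ-trans (lc-* (- 1#) _ (lookup σ)) (≈ᴹ-trans (-1*ₗ _) (-ᴹ‿cong (expand e ρ σ)))
      expand (a ⊛ e) ρ σ = ≈ᴹ-trans (lc-* _ _ (lookup σ)) (*ₗ-congˡ (expand e ρ σ))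

      -- A nested product, so that the proofs for the individual vectors can be given as a tuple of
      -- `refl`, each checked by normalizing a pair of coefficients.
      AllFin : ∀ q → (Fin q → Set ℓ) → Set ℓ
      AllFin zero    P = ⊤
      AllFin (suc q) P = P zero × AllFin q (P ∘ suc)

      lookupAll : ∀ {q} {P : Fin q → Set ℓ} → AllFin q P → ∀ j → P j
      lookupAll {suc q} (p , ps) zero    = p
      lookupAll {suc q} (p , ps) (suc j) = lookupAll ps j

    solveᴹ : ∀ {p q} ρ σ (e f : Expr p q) →
      AllFin q (λ j → S.⟦ coefficient e j ⟧↓ ρ ≈ S.⟦ coefficient f j ⟧↓ ρ) → ⟦ e ⟧ᴹ ρ σ ≈ᴹ ⟦ f ⟧ᴹ ρ σ
    solveᴹ ρ σ e f same = ≈ᴹ-trans (≈ᴹ-sym (expand e ρ σ)) (≈ᴹ-trans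
      (lc-congˡ (lookup σ) (λ j → trans (sym (S.correct (coefficient e j) ρ)) (trans (lookupAll same j) (S.correct (coefficient f j) ρ))))
      (expand f ρ σ))

  open ModuleSolver public
  open S using (var; con; _:+_; _:*_; :-_)


  lc-shift : ∀ {n} (a t : Vector Carrier n) w b →
    linearCombination a (λ j → t j *ₗ w +ᴹ b j) ≈ᴹ sum (λ j → a j * t j) *ₗ w +ᴹ linearCombination a b
  lc-shift {zero}  a t w b = ≈ᴹ-sym (≈ᴹ-trans (+ᴹ-identityʳ _) (*ₗ-zeroˡ w))
  lc-shift {suc n} a t w b = ≈ᴹ-trans (+ᴹ-congˡ (lc-shift (tail a) (tail t) w (tail b)))
    (solveᴹ (a zero ▸ t zero ▸ _ ▸ []) (w ▸ b zero ▸ _ ▸ [])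
       (var 0F ⊛ (var 1F ⊛ vec 0F ⊕ vec 1F) ⊕ (var 2F ⊛ vec 0F ⊕ vec 2F))
       ((var 0F :* var 1F :+ var 2F) ⊛ vec 0F ⊕ (var 0F ⊛ vec 1F ⊕ vec 2F))
       (refl , refl , refl , tt))

  -- When the columns of P are coordinate vectors, coefficients transform by x ↦ P x. This links
  -- composition of linear maps to `_⊗_`.
  lc-lc : ∀ {n k} (x : Vector Carrier k) (P : Fin n → Fin k → Carrier) b →
    linearCombination x (λ j → linearCombination (λ i → P i j) b) ≈ᴹ linearCombination (λ i → sum λ j → P i j * x j) b
  lc-lc {n} {zero} x P b = ≈ᴹ-sym (lc-zero b (λ _ → refl))
  lc-lc {n} {suc k} x P b = begin
    x zero *ₗ linearCombination (λ i → P i zero) b +ᴹ linearCombination (tail x) (λ j → linearCombination (λ i → P i (suc j)) b)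
      ≈⟨ +ᴹ-cong (≈ᴹ-sym (lc-* (x zero) (λ i → P i zero) b)) (lc-lc (tail x) (λ i j → P i (suc j)) b) ⟩
    linearCombination (λ i → x zero * P i zero) b +ᴹ linearCombination (λ i → sum λ j → P i (suc j) * x (suc j)) b
      ≈⟨ lc-+ (λ i → x zero * P i zero) (λ i → sum λ j → P i (suc j) * x (suc j)) b ⟨
    linearCombination (λ i → x zero * P i zero + sum λ j → P i (suc j) * x (suc j)) b
      ≈⟨ lc-congˡ b (λ i → +-congʳ (*-comm (x zero) (P i zero))) ⟩
    linearCombination (λ i → sum λ j → P i j * x j) b ∎

  record Functional : Set (c ⊔ ℓ ⊔ μ ⊔ ℓμ) where
    field
      ⟪_⟫    : Carrierᴹ → Carrier
      cong   : ∀ {u v} → u ≈ᴹ v → ⟪ u ⟫ ≈ ⟪ v ⟫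
      +-homo : ∀ u v → ⟪ u +ᴹ v ⟫ ≈ ⟪ u ⟫ + ⟪ v ⟫
      *-homo : ∀ a v → ⟪ a *ₗ v ⟫ ≈ a * ⟪ v ⟫

    0-homo : ⟪ 0ᴹ ⟫ ≈ 0#
    0-homo = trans (cong (≈ᴹ-sym (*ₗ-zeroˡ 0ᴹ))) (trans (*-homo 0# 0ᴹ) (zeroˡ _))

    neg-homo : ∀ v → ⟪ -ᴹ v ⟫ ≈ - ⟪ v ⟫
    neg-homo v = trans (cong (solveᴹ [] (v ▸ []) (⊝ vec 0F) (con -[1+ 0 ] ⊛ vec 0F) (refl , tt)))
      (trans (*-homo (- 1#) v) (S.solve 1 (λ a → con -[1+ 0 ] :* a S.:= :- a) refl ⟪ v ⟫))

    lc-homo-0 : ∀ {n} (a : Vector Carrier n) b → (∀ i → ⟪ b i ⟫ ≈ 0#) → ⟪ linearCombination a b ⟫ ≈ 0#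
    lc-homo-0 {zero}  a b p = 0-homo
    lc-homo-0 {suc n} a b p = trans (+-homo _ _) (trans (+-cong
      (trans (*-homo (a zero) (b zero)) (trans (*-congˡ (p zero)) (zeroʳ _))) (lc-homo-0 (tail a) (tail b) (p ∘ suc))) (+-identityˡ 0#))

  open Functional public using (⟪_⟫)

  Ker : Functional → Pred Carrierᴹ ℓ
  Ker φ v = ⟪ φ ⟫ v ≈ 0#

  basis-resp : ∀ {s s′} {S : Pred Carrierᴹ s} {T : Pred Carrierᴹ s′} {n} {b : Vector Carrierᴹ n} →
    S ≐ T → IsBasis S b → IsBasis T b
  basis-resp (S⊆T , T⊆S) isBasis = record
    { within      = λ i → S⊆T (within i)
    ; independent = independent
    ; spanning    = λ v v∈T → spanning v (T⊆S v∈T)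
    }
    where open IsBasis isBasis

-- The kernel of a functional on a subspace

module LinearAlgebra (ℝ : RealField c ℓ₁ ℓ₂) (V : Module (RealField.commutativeRing ℝ) μ ℓμ) where
  open RealField ℝ using (commutativeRing; inverse)
  open CommutativeRing commutativeRing hiding (zero)
  open Module V
  open RealFieldProperties ℝ public
  open LinearCombinations V public
  private
    module S = IntegerSolver commutativeRing
  open S using (var; con; _:+_; _:*_; :-_)
  open SetoidReasoning ≈ᴹ-setoid

  *ₗ-cancel : ∀ {a v} → ¬ a ≈ 0# → a *ₗ v ≈ᴹ 0ᴹ → v ≈ᴹ 0ᴹ
  *ₗ-cancel {a} {v} a≉0 av≈0 with inverse a a≉0
  ... | z , az≈1 = begin
    v              ≈⟨ *ₗ-identityˡ v ⟨
    1# *ₗ v        ≈⟨ *ₗ-congʳ (trans (*-comm z a) az≈1) ⟨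
    (z * a) *ₗ v   ≈⟨ *ₗ-assoc z a v ⟩
    z *ₗ a *ₗ v    ≈⟨ *ₗ-congˡ av≈0 ⟩
    z *ₗ 0ᴹ        ≈⟨ *ₗ-zeroʳ z ⟩
    0ᴹ             ∎

  -- With `u i` as pivot, every other basis vector is moved into the kernel by adding a multiple of
  -- `u i`; the shifted vectors form the new basis.
  kernel-dimension : ∀ {s} {S : Pred Carrierᴹ s} {d} {u : Vector Carrierᴹ (suc d)} → IsBasis S u →
    (∀ a {v w} → S v → S w → S (a *ₗ v +ᴹ w)) →
    (φ : Functional) (i : Fin (suc d)) → ¬ ⟪ φ ⟫ (u i) ≈ 0# → HasDimension (S ∩ Ker φ) d
  kernel-dimension {S = S} {d} {u} isBasis closed φ i φuᵢ≉0 = b , record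
    { within      = λ j → closed (t j) (within i) (within (punchIn i j)) , φ-b j
    ; independent = b-independent
    ; spanning    = λ v (v∈S , φv≈0) → b-spanning v v∈S φv≈0
    }
    where
    open IsBasis isBasis
    module φ = Functional φ
    y = proj₁ (inverse _ φuᵢ≉0)
    u′ : Vector Carrierᴹ d
    u′ = removeAt u i
    t : Vector Carrier d
    t j = - (⟪ φ ⟫ (u′ j) * y)
    b : Vector Carrierᴹ d
    b j = t j *ₗ u i +ᴹ u′ j
    φ-b : ∀ j → ⟪ φ ⟫ (b j) ≈ 0#
    φ-b j = trans (φ.+-homo _ _) (trans (+-congʳ (φ.*-homo (t j) (u i)))
      (trans (S.solve 3 (λ f y p → :- (f :* y) :* p :+ f S.:= f :* (con (+ 1) :+ :- (p :* y))) refl (⟪ φ ⟫ (u′ j)) y (⟪ φ ⟫ (u i)))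
        (trans (*-congˡ (trans (+-congˡ (-‿cong (proj₂ (inverse _ φuᵢ≉0)))) (-‿inverseʳ 1#))) (zeroʳ _))))
    b-independent : ∀ a → linearCombination a b ≈ᴹ 0ᴹ → ∀ j → a j ≈ 0#
    b-independent a p j = trans (sym (reflexive (insertAt-punchIn a i τ j))) (independent (insertAt a i τ) q (punchIn i j))
      where
      open SemiringSum semiring using (sum)
      -- The coefficient that `u i` acquires when a combination of b is rewritten in u.
      τ = sum (λ j → a j * t j)
      q : linearCombination (insertAt a i τ) u ≈ᴹ 0ᴹ
      q = begin
        linearCombination (insertAt a i τ) u
          ≈⟨ lc-remove (insertAt a i τ) u i ⟩
        insertAt a i τ i *ₗ u i +ᴹ linearCombination (removeAt (insertAt a i τ) i) u′
          ≈⟨ +ᴹ-cong (*ₗ-congʳ (reflexive (insertAt-lookup a i τ))) (lc-congˡ u′ (λ j → reflexive (insertAt-punchIn a i τ j))) ⟩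
        τ *ₗ u i +ᴹ linearCombination a u′
          ≈⟨ lc-shift a t (u i) u′ ⟨
        linearCombination a b
          ≈⟨ p ⟩
        0ᴹ ∎
    b-spanning : ∀ v → S v → ⟪ φ ⟫ v ≈ 0# → ∃[ a ] linearCombination a b ≈ᴹ v
    b-spanning v v∈S φv≈0 = a , (begin
      linearCombination a b                          ≈⟨ solveᴹ [] (v ▸ linearCombination a b ▸ []) (vec 1F) (vec 0F ⊕ ⊝ (vec 0F ⊕ ⊝ vec 1F)) (refl , refl , tt) ⟩
      v +ᴹ -ᴹ (v +ᴹ -ᴹ linearCombination a b)        ≈⟨ +ᴹ-congˡ (-ᴹ‿cong (≈ᴹ-trans difference (≈ᴹ-trans (*ₗ-congʳ σ≈0) (*ₗ-zeroˡ (u i))))) ⟩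
      v +ᴹ -ᴹ 0ᴹ                                     ≈⟨ solveᴹ [] (v ▸ []) (vec 0F ⊕ ⊝ 𝟘) (vec 0F) (refl , tt) ⟩
      v                                              ∎)
      where
      open SemiringSum semiring using (sum)
      x = proj₁ (spanning v v∈S)
      a = removeAt x i
      τ = sum (λ j → a j * t j)
      difference : v +ᴹ -ᴹ linearCombination a b ≈ᴹ (x i + - τ) *ₗ u i
      difference = begin
        v +ᴹ -ᴹ linearCombination a b
          ≈⟨ +ᴹ-cong (≈ᴹ-trans (≈ᴹ-sym (proj₂ (spanning v v∈S))) (lc-remove x u i)) (-ᴹ‿cong (lc-shift a t (u i) u′)) ⟩
        (x i *ₗ u i +ᴹ linearCombination a u′) +ᴹ -ᴹ (τ *ₗ u i +ᴹ linearCombination a u′)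
          ≈⟨ solveᴹ (x i ▸ τ ▸ []) (u i ▸ linearCombination a u′ ▸ [])
               ((var 0F ⊛ vec 0F ⊕ vec 1F) ⊕ ⊝ (var 1F ⊛ vec 0F ⊕ vec 1F)) ((var 0F :+ :- var 1F) ⊛ vec 0F) (refl , refl , tt) ⟩
        (x i + - τ) *ₗ u i ∎
      -- The difference is a multiple of `u i` and is killed by φ, as v and all `b j` are; the pivot
      -- is not.
      σ≈0 : x i + - τ ≈ 0#
      σ≈0 = *-cancel-0 φuᵢ≉0 (trans (*-comm _ _) (trans (sym (φ.*-homo _ (u i))) (trans (φ.cong (≈ᴹ-sym difference))
        (trans (φ.+-homo _ _) (trans (+-cong φv≈0 (trans (φ.neg-homo _) (-‿cong (φ.lc-homo-0 a b φ-b))))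
          (S.solve 0 (con (+ 0) :+ :- con (+ 0) S.:= con (+ 0)) refl))))))

-- Complements of a linearly independent family

module Complements (ℝ : RealField c ℓ₁ ℓ₂) (V : Module (RealField.commutativeRing ℝ) μ ℓμ) where
  open RealField ℝ using (commutativeRing; inverse)
  open CommutativeRing commutativeRing hiding (zero)
  open Module V
  open LinearAlgebra ℝ V
  private
    module S = IntegerSolver commutativeRing
    module D = Determinants commutativeRing
  open S using (var; con; _:+_; _:*_; :-_)
  open SetoidReasoning ≈ᴹ-setoid

  -- The families e and u together form a basis of V.
  record IsComplement {k d} (e : Vector Carrierᴹ k) (u : Vector Carrierᴹ d) : Set (c ⊔ ℓ₁ ⊔ μ ⊔ ℓμ) where
    field
      independent : ∀ a b → linearCombination a e +ᴹ linearCombination b u ≈ᴹ 0ᴹ → (∀ i → a i ≈ 0#) × (∀ j → b j ≈ 0#)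
      spanning    : ∀ v → ∃[ a ] ∃[ b ] linearCombination a e +ᴹ linearCombination b u ≈ᴹ v

    coordinate : Fin k → Carrierᴹ → Carrier
    coordinate i v = proj₁ (spanning v) i

    remainder : Carrierᴹ → Vector Carrier d
    remainder v = proj₁ (proj₂ (spanning v))

    decompose : ∀ v → v ≈ᴹ linearCombination (λ i → coordinate i v) e +ᴹ linearCombination (remainder v) u
    decompose v = ≈ᴹ-sym (proj₂ (proj₂ (spanning v)))

    -- The coordinates are merely chosen by `spanning`. Their congruence, their linearity and their
    -- values on e and u all come from this uniqueness.
    coordinate-unique : ∀ {v} a b → v ≈ᴹ linearCombination a e +ᴹ linearCombination b u → ∀ i → coordinate i v ≈ a i
    coordinate-unique {v} a b p i = x-y≈0⇒x≈y (trans
      (S.solve 2 (λ x y → x :+ :- y S.:= con -[1+ 0 ] :* y :+ x) refl (coordinate i v) (a i))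
      (proj₁ (independent (λ i → - 1# * a i + coordinate i v) (λ j → - 1# * b j + remainder v j) (begin
        linearCombination (λ i → - 1# * a i + coordinate i v) e +ᴹ linearCombination (λ j → - 1# * b j + remainder v j) u
          ≈⟨ +ᴹ-cong (≈ᴹ-trans (lc-+ _ _ e) (+ᴹ-congʳ (lc-* (- 1#) a e))) (≈ᴹ-trans (lc-+ _ _ u) (+ᴹ-congʳ (lc-* (- 1#) b u))) ⟩
        (- 1# *ₗ lae +ᴹ lve) +ᴹ (- 1# *ₗ lbu +ᴹ lvu)
          ≈⟨ solveᴹ [] (lae ▸ lve ▸ lbu ▸ lvu ▸ [])
               ((con -[1+ 0 ] ⊛ vec 0F ⊕ vec 1F) ⊕ (con -[1+ 0 ] ⊛ vec 2F ⊕ vec 3F)) ((vec 1F ⊕ vec 3F) ⊕ ⊝ (vec 0F ⊕ vec 2F))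
               (refl , refl , refl , refl , tt) ⟩
        (lve +ᴹ lvu) +ᴹ -ᴹ (lae +ᴹ lbu)
          ≈⟨ +ᴹ-cong (≈ᴹ-sym (decompose v)) (-ᴹ‿cong (≈ᴹ-sym p)) ⟩
        v +ᴹ -ᴹ v
          ≈⟨ -ᴹ‿inverseʳ v ⟩
        0ᴹ ∎)) i))
      where
      lae = linearCombination a e
      lve = linearCombination (λ i → coordinate i v) e
      lbu = linearCombination b u
      lvu = linearCombination (remainder v) u

    functional : Fin k → Functional
    functional i = record
      { ⟪_⟫    = coordinate i
      ; cong   = λ {u′} {v} p → coordinate-unique (λ i → coordinate i v) (remainder v) (≈ᴹ-trans p (decompose v)) i
      ; +-homo = λ v w → coordinate-unique (λ i → coordinate i v + coordinate i w) (λ j → remainder v j + remainder w j)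
          (≈ᴹ-trans (+ᴹ-cong (decompose v) (decompose w))
          (≈ᴹ-trans (solveᴹ [] (_ ▸ _ ▸ _ ▸ _ ▸ []) ((vec 0F ⊕ vec 1F) ⊕ (vec 2F ⊕ vec 3F)) ((vec 0F ⊕ vec 2F) ⊕ (vec 1F ⊕ vec 3F)) (refl , refl , refl , refl , tt))
                    (+ᴹ-cong (≈ᴹ-sym (lc-+ _ _ e)) (≈ᴹ-sym (lc-+ _ _ u))))) i
      ; *-homo = λ a v → coordinate-unique (λ i → a * coordinate i v) (λ j → a * remainder v j)
          (≈ᴹ-trans (*ₗ-congˡ (decompose v)) (≈ᴹ-trans (*ₗ-distribˡ a _ _)
                    (+ᴹ-cong (≈ᴹ-sym (lc-* a _ e)) (≈ᴹ-sym (lc-* a _ u))))) i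
      }

    coordinate-e : ∀ i j → coordinate i (e j) ≈ D.unit j i
    coordinate-e i j = coordinate-unique (D.unit j) (λ _ → 0#)
      (≈ᴹ-sym (≈ᴹ-trans (+ᴹ-cong (lc-unit e j) (lc-zero u (λ _ → refl))) (+ᴹ-identityʳ _))) i

    coordinate-lc : ∀ i b → coordinate i (linearCombination b u) ≈ 0#
    coordinate-lc i b = coordinate-unique (λ _ → 0#) b
      (≈ᴹ-sym (≈ᴹ-trans (+ᴹ-congʳ (lc-zero e (λ _ → refl))) (+ᴹ-identityˡ _))) i

  LinearlyIndependent : ∀ {d} → Vector Carrierᴹ d → Set _
  LinearlyIndependent u = ∀ a → linearCombination a u ≈ᴹ 0ᴹ → ∀ i → a i ≈ 0#

  -- Steinitz exchange.
  exchange : ∀ {k d} {e : Vector Carrierᴹ (suc k)} {u : Vector Carrierᴹ (suc d)} →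
    LinearlyIndependent u → IsComplement e (tail u) → ∃[ i ] IsComplement (removeAt e i) u
  exchange {k} {d} {e} {u} u-independent complement with any? (λ i → ¬? (coordinate i (u zero) ≟ 0#))
    where open IsComplement complement
  -- Without a nonzero coordinate along e, `u zero` would be a combination of `tail u`,
  -- contradicting independence.
  ... | no none = ⊥-elim (1≉0 (u-independent (1# ∷ (λ j → - remainder (u zero) j)) relation zero))
    where
    open IsComplement complement
    u₀≈ : u zero ≈ᴹ linearCombination (remainder (u zero)) (tail u)
    u₀≈ = ≈ᴹ-trans (decompose (u zero)) (≈ᴹ-trans
      (+ᴹ-congʳ (lc-zero e (λ i → decidable-stable (_ ≟ 0#) (λ ≉0 → none (i , ≉0))))) (+ᴹ-identityˡ _))
    relation : linearCombination (1# ∷ (λ j → - remainder (u zero) j)) u ≈ᴹ 0ᴹ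
    relation = begin
      1# *ₗ u zero +ᴹ linearCombination (λ j → - remainder (u zero) j) (tail u)
        ≈⟨ +ᴹ-cong (*ₗ-identityˡ _) (lc-congˡ (tail u) (λ j → S.solve 1 (λ x → :- x S.:= con -[1+ 0 ] :* x) refl _)) ⟩
      u zero +ᴹ linearCombination (λ j → - 1# * remainder (u zero) j) (tail u)
        ≈⟨ +ᴹ-congˡ (≈ᴹ-trans (lc-* (- 1#) _ (tail u)) (*ₗ-congˡ (≈ᴹ-sym u₀≈))) ⟩
      u zero +ᴹ - 1# *ₗ u zero
        ≈⟨ solveᴹ [] (u zero ▸ []) (vec 0F ⊕ con -[1+ 0 ] ⊛ vec 0F) 𝟘 (refl , tt) ⟩
      0ᴹ ∎
  ... | yes (i , xᵢ≉0) = i , record { independent = new-independent ; spanning = new-spanning }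
    where
    open IsComplement complement
    e′ = removeAt e i
    u′ = tail u
    x : Vector Carrier (suc k)
    x i = coordinate i (u zero)
    x′ = removeAt x i
    r = remainder (u zero)
    y = proj₁ (inverse (x i) xᵢ≉0)
    xy≈1 = proj₂ (inverse (x i) xᵢ≉0)

    u₀≈ : u zero ≈ᴹ (x i *ₗ e i +ᴹ linearCombination x′ e′) +ᴹ linearCombination r u′
    u₀≈ = ≈ᴹ-trans (decompose (u zero)) (+ᴹ-congʳ (lc-remove x e i))

    new-independent : ∀ a b → linearCombination a e′ +ᴹ linearCombination b u ≈ᴹ 0ᴹ → (∀ i → a i ≈ 0#) × (∀ j → b j ≈ 0#)
    new-independent a b p = a≈0 , λ { zero → z≈0 ; (suc j) → b≈0 j }
      where
      z = b zero
      -- Replacing `u zero` by its decomposition turns the given relation into one between e and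
      -- `tail u`. Its coefficient at `e i` is z times the pivot, which forces z = 0.
      a⁺ : Vector Carrier k
      a⁺ j = z * x′ j + a j
      A = insertAt a⁺ i (z * x i)
      B : Vector Carrier d
      B j = z * r j + b (suc j)
      relation : linearCombination A e +ᴹ linearCombination B u′ ≈ᴹ 0ᴹ
      relation = begin
        linearCombination A e +ᴹ linearCombination B u′
          ≈⟨ +ᴹ-cong (lc-remove A e i) (≈ᴹ-trans (lc-+ _ _ u′) (+ᴹ-congʳ (lc-* z r u′))) ⟩
        (A i *ₗ e i +ᴹ linearCombination (removeAt A i) e′) +ᴹ (z *ₗ linearCombination r u′ +ᴹ linearCombination (tail b) u′)
          ≈⟨ +ᴹ-congʳ (+ᴹ-cong (*ₗ-congʳ (reflexive (insertAt-lookup a⁺ i (z * x i))))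
               (≈ᴹ-trans (lc-congˡ e′ (λ j → reflexive (insertAt-punchIn a⁺ i (z * x i) j)))
                 (≈ᴹ-trans (lc-+ _ _ e′) (+ᴹ-congʳ (lc-* z x′ e′))))) ⟩
        ((z * x i) *ₗ e i +ᴹ (z *ₗ linearCombination x′ e′ +ᴹ linearCombination a e′)) +ᴹ (z *ₗ linearCombination r u′ +ᴹ linearCombination (tail b) u′)
          ≈⟨ solveᴹ (z ▸ x i ▸ []) (e i ▸ linearCombination x′ e′ ▸ linearCombination a e′ ▸ linearCombination r u′ ▸ linearCombination (tail b) u′ ▸ [])
               (((var 0F :* var 1F) ⊛ vec 0F ⊕ (var 0F ⊛ vec 1F ⊕ vec 2F)) ⊕ (var 0F ⊛ vec 3F ⊕ vec 4F))
               (vec 2F ⊕ (var 0F ⊛ ((var 1F ⊛ vec 0F ⊕ vec 1F) ⊕ vec 3F) ⊕ vec 4F))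
               (refl , refl , refl , refl , refl , tt) ⟩
        linearCombination a e′ +ᴹ (z *ₗ ((x i *ₗ e i +ᴹ linearCombination x′ e′) +ᴹ linearCombination r u′) +ᴹ linearCombination (tail b) u′)
          ≈⟨ +ᴹ-congˡ (+ᴹ-congʳ (*ₗ-congˡ (≈ᴹ-sym u₀≈))) ⟩
        linearCombination a e′ +ᴹ linearCombination b u
          ≈⟨ p ⟩
        0ᴹ ∎
      A≈0 = proj₁ (independent A B relation)
      z≈0 : z ≈ 0#
      z≈0 = *-cancel-0 xᵢ≉0 (trans (*-comm (x i) z) (trans (reflexive (≡.sym (insertAt-lookup a⁺ i (z * x i)))) (A≈0 i)))
      vanish : ∀ w {a} → z * w + a ≈ 0# → a ≈ 0#
      vanish w q = trans (sym (trans (+-congʳ (trans (*-congʳ z≈0) (zeroˡ w))) (+-identityˡ _))) q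
      a≈0 : ∀ j → a j ≈ 0#
      a≈0 j = vanish (x′ j) (trans (reflexive (≡.sym (insertAt-punchIn a⁺ i (z * x i) j))) (A≈0 (punchIn i j)))
      b≈0 : ∀ j → b (suc j) ≈ 0#
      b≈0 j = vanish (r j) (proj₂ (independent A B relation) j)

    new-spanning : ∀ v → ∃[ a ] ∃[ b ] linearCombination a e′ +ᴹ linearCombination b u ≈ᴹ v
    new-spanning v = (λ j → - t * x′ j + w′ j) , (t ∷ (λ j → - t * r j + q j)) , (begin
      linearCombination (λ j → - t * x′ j + w′ j) e′ +ᴹ (t *ₗ u zero +ᴹ linearCombination (λ j → - t * r j + q j) u′)
        ≈⟨ +ᴹ-cong (≈ᴹ-trans (lc-+ _ _ e′) (+ᴹ-congʳ (lc-* (- t) x′ e′)))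
             (+ᴹ-cong (*ₗ-congˡ u₀≈) (≈ᴹ-trans (lc-+ _ _ u′) (+ᴹ-congʳ (lc-* (- t) r u′)))) ⟩
      (- t *ₗ linearCombination x′ e′ +ᴹ linearCombination w′ e′) +ᴹ (t *ₗ ((x i *ₗ e i +ᴹ linearCombination x′ e′) +ᴹ linearCombination r u′) +ᴹ (- t *ₗ linearCombination r u′ +ᴹ linearCombination q u′))
        ≈⟨ solveᴹ (t ▸ x i ▸ []) (e i ▸ linearCombination x′ e′ ▸ linearCombination w′ e′ ▸ linearCombination r u′ ▸ linearCombination q u′ ▸ [])
             ((:- var 0F ⊛ vec 1F ⊕ vec 2F) ⊕ (var 0F ⊛ ((var 1F ⊛ vec 0F ⊕ vec 1F) ⊕ vec 3F) ⊕ (:- var 0F ⊛ vec 3F ⊕ vec 4F)))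
             (((var 0F :* var 1F) ⊛ vec 0F ⊕ vec 2F) ⊕ vec 4F)
             (refl , refl , refl , refl , refl , tt) ⟩
      ((t * x i) *ₗ e i +ᴹ linearCombination w′ e′) +ᴹ linearCombination q u′
        ≈⟨ +ᴹ-congʳ (+ᴹ-congʳ (*ₗ-congʳ tx≈w)) ⟩
      (w i *ₗ e i +ᴹ linearCombination w′ e′) +ᴹ linearCombination q u′
        ≈⟨ +ᴹ-congʳ (≈ᴹ-sym (lc-remove w e i)) ⟩
      linearCombination w e +ᴹ linearCombination q u′
        ≈⟨ decompose v ⟨
      v ∎)
      where
      w : Vector Carrier (suc k)
      w i = coordinate i v
      w′ = removeAt w i
      q = remainder v
      -- The coefficient of `u zero` that accounts for the whole component of v along the removed
      -- vector `e i`.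
      t = w i * y
      tx≈w : t * x i ≈ w i
      tx≈w = trans (S.solve 3 (λ w y x → (w :* y) :* x S.:= w :* (x :* y)) refl (w i) y (x i)) (trans (*-congˡ xy≈1) (*-identityʳ _))

  tail-independent : ∀ {d} {u : Vector Carrierᴹ (suc d)} → LinearlyIndependent u → LinearlyIndependent (tail u)
  tail-independent {u = u} u-independent a p i =
    u-independent (0# ∷ a) (≈ᴹ-trans (+ᴹ-congʳ (*ₗ-zeroˡ (u zero))) (≈ᴹ-trans (+ᴹ-identityˡ _) p)) (suc i)

  module _ (fd : FiniteDimensional) where
    open FiniteDimensional fd

    -- Beginning with the basis of V, the vectors of u are exchanged in from last to first. Each one
    -- displaces a single vector of e, so the count k + d is preserved.
    complement : ∀ {d} k {u : Vector Carrierᴹ d} → LinearlyIndependent u → k ℕ.+ d ≡ dimension → ∃[ e ] IsComplement {k} e u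
    complement {zero} k {u} _ k+0≡n = go (≡.trans (≡.sym (ℕ.+-identityʳ k)) k+0≡n)
      where
      go : k ≡ dimension → ∃[ e ] IsComplement {k} e u
      go ≡.refl = basis , record
        { independent = λ a b p → IsBasis.independent isBasis a (≈ᴹ-trans (≈ᴹ-sym (+ᴹ-identityʳ _)) p) , λ ()
        ; spanning    = λ v → let a , p = IsBasis.spanning isBasis v _ in a , (λ ()) , ≈ᴹ-trans (+ᴹ-identityʳ _) p
        }
    complement {suc d} k {u} u-independent k+d≡n
      with complement (suc k) (tail-independent {u = u} u-independent) (≡.trans (≡.sym (ℕ.+-suc k d)) k+d≡n)
    ... | e , e-complement with exchange {u = u} u-independent e-complement
    ... | i , e′-complement = removeAt e i , e′-complement

-- Determinants of automorphisms and change of basis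

module AutomorphismDeterminants (ℝ : RealField c ℓ₁ ℓ₂) (V : Module (RealField.commutativeRing ℝ) μ ℓμ)
                                (fd : Dimension.FiniteDimensional V) where
  open RealField ℝ using (commutativeRing)
  open CommutativeRing commutativeRing hiding (zero)
  open Module V
  open LinearAlgebra ℝ V
  open GeneralLinear V
  open Reflections V fd
  open FiniteDimensional fd
  open Determinants commutativeRing hiding (_≋_)
  open SemiringSum semiring using (sum)
  private
    module S = IntegerSolver commutativeRing
  open S using (con; _:+_; _:*_; :-_)

  image-lc : ∀ (g : Automorphism) {n} (a : Vector Carrier n) b → ⟦ g ⟧ (linearCombination a b) ≈ᴹ linearCombination a (⟦ g ⟧ ∘ b)
  image-lc g {zero}  a b = Automorphism.0ᴹ-homo g
  image-lc g {suc n} a b = ≈ᴹ-trans (Automorphism.+ᴹ-homo g _ _)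
    (+ᴹ-cong (Automorphism.*ₗ-homo g (a zero) (b zero)) (image-lc g (tail a) (tail b)))

  basis-lc-injective : ∀ {a b} → linearCombination a basis ≈ᴹ linearCombination b basis → ∀ i → a i ≈ b i
  basis-lc-injective {a} {b} p i = x-y≈0⇒x≈y (trans (S.solve 2 (λ x y → x :+ :- y S.:= :- con (+ 1) :* y :+ x) refl (a i) (b i))
    (IsBasis.independent isBasis (λ i → - 1# * b i + a i) (≈ᴹ-trans (lc-+ _ _ basis)
      (≈ᴹ-trans (+ᴹ-cong (lc-* (- 1#) b basis) p)
        (solveᴹ [] (linearCombination b basis ▸ []) (con -[1+ 0 ] ⊛ vec zero ⊕ vec zero) 𝟘 (refl , tt)))) i))

  lc-coordinates : ∀ v → linearCombination (coordinates v) basis ≈ᴹ v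
  lc-coordinates v = proj₂ (IsBasis.spanning isBasis v _)

  Represents : ∀ {n} → Vector Carrierᴹ n → SquareMatrix n → Automorphism → Set ℓμ
  Represents b M g = ∀ j → ⟦ g ⟧ (b j) ≈ᴹ linearCombination (λ i → M i j) b

  image-family : ∀ {n} (g : Automorphism) {b : Vector Carrierᴹ n} {M} → Represents b M g →
    ∀ a → ⟦ g ⟧ (linearCombination a b) ≈ᴹ linearCombination (λ i → sum λ j → M i j * a j) b
  image-family g {b} {M} rep a = ≈ᴹ-trans (image-lc g a b) (≈ᴹ-trans (lc-cong (λ _ → refl) rep) (lc-lc a M b))

  matrix-represents : ∀ g → Represents basis (matrix g) g
  matrix-represents g j = ≈ᴹ-sym (lc-coordinates (⟦ g ⟧ (basis j)))

  -- P holds the coordinates of b in `basis`, and Q those of `basis` in b. Then P Q = 1, and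
  -- `matrix g` times P equals P M, so multiplicativity lets the determinants of P and Q cancel.
  det-in-basis : ∀ {n} {b : Vector Carrierᴹ n} → n ≡ dimension → (∀ v → ∃[ a ] linearCombination a b ≈ᴹ v) →
    ∀ {M} g → Represents b M g → det g ≈ determinant n M
  det-in-basis {b = b} ≡.refl spans {M} g rep = begin
    det g                       ≈⟨ *-identityʳ _ ⟨
    det g * 1#                  ≈⟨ *-congˡ PQ≈1 ⟨
    det g * (|P| * |Q|)         ≈⟨ *-assoc _ _ _ ⟨
    (det g * |P|) * |Q|         ≈⟨ *-congʳ intertwine ⟩
    (|P| * |M|) * |Q|           ≈⟨ S.solve 3 (λ p m q → (p :* m) :* q S.:= m :* (p :* q)) refl |P| |M| |Q| ⟩
    |M| * (|P| * |Q|)           ≈⟨ *-congˡ PQ≈1 ⟩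
    |M| * 1#                    ≈⟨ *-identityʳ _ ⟩
    |M|                         ∎
    where
    open SetoidReasoning setoid
    P Q : SquareMatrix dimension
    P i j = coordinates (b j) i
    Q i j = proj₁ (spans (basis j)) i
    |P| = determinant dimension P
    |Q| = determinant dimension Q
    |M| = determinant dimension M
    via-P : ∀ a → linearCombination a b ≈ᴹ linearCombination (λ i → sum λ j → P i j * a j) basis
    via-P a = ≈ᴹ-trans (lc-cong (λ _ → refl) (λ j → ≈ᴹ-sym (lc-coordinates (b j)))) (lc-lc a P basis)
    PQ≈1 : |P| * |Q| ≈ 1#
    PQ≈1 = begin
      |P| * |Q|                     ≈⟨ determinant-⊗ dimension P Q ⟨
      determinant dimension (P ⊗ Q) ≈⟨ determinant-cong dimension (λ i j → basis-lc-injective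
        (≈ᴹ-trans (≈ᴹ-sym (via-P (λ i → Q i j))) (≈ᴹ-trans (proj₂ (spans (basis j))) (≈ᴹ-sym (lc-unit basis j)))) i) ⟩
      determinant dimension (λ i j → unit j i) ≈⟨ determinant-cong dimension unit-sym ⟩
      determinant dimension unit    ≈⟨ determinant-unit dimension ⟩
      1#                            ∎
    intertwine : det g * |P| ≈ |P| * |M|
    intertwine = begin
      det g * |P|                          ≈⟨ determinant-⊗ dimension (matrix g) P ⟨
      determinant dimension (matrix g ⊗ P) ≈⟨ determinant-cong dimension (λ i j → basis-lc-injective
        (≈ᴹ-trans (≈ᴹ-sym (image-family g (matrix-represents g) (λ i → P i j)))
          (≈ᴹ-trans (Automorphism.⟦⟧-cong g (lc-coordinates (b j))) (≈ᴹ-trans (rep j) (via-P (λ i → M i j))))) i) ⟩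
      determinant dimension (P ⊗ M)        ≈⟨ determinant-⊗ dimension P M ⟩
      |P| * |M|                            ∎

  det-cong : ∀ {g h} → (∀ v → ⟦ g ⟧ v ≈ᴹ ⟦ h ⟧ v) → det g ≈ det h
  det-cong {g} {h} g≈h = determinant-cong dimension (λ i j → basis-lc-injective
    (≈ᴹ-trans (lc-coordinates _) (≈ᴹ-trans (g≈h (basis j)) (≈ᴹ-sym (lc-coordinates _)))) i)

  open Group GL using (_∙_; ε; _⁻¹)
  open GroupTheory GL using (HasFiniteOrder) renaming (_^_ to _^ᴬ_)

  det-∙ : ∀ g h → det (g ∙ h) ≈ det g * det h
  det-∙ g h = trans
    (determinant-cong dimension (λ i j → basis-lc-injective (≈ᴹ-trans (lc-coordinates _)
      (≈ᴹ-trans (Automorphism.⟦⟧-cong g (≈ᴹ-sym (lc-coordinates _))) (image-family g (matrix-represents g) (λ i → matrix h i j)))) i))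
    (determinant-⊗ dimension (matrix g) (matrix h))

  det-ε : det ε ≈ 1#
  det-ε = trans
    (determinant-cong dimension (λ i j → trans (basis-lc-injective
      (≈ᴹ-trans (lc-coordinates _) (≈ᴹ-sym (lc-unit basis j))) i) (unit-sym i j)))
    (determinant-unit dimension)

  det-⁻¹ : ∀ {g} → det g ≈ 1# → det (g ⁻¹) ≈ 1#
  det-⁻¹ {g} g≈1 = trans (sym (*-identityˡ _)) (trans (*-congʳ (sym g≈1))
    (trans (sym (det-∙ g (g ⁻¹))) (trans (det-cong {g ∙ g ⁻¹} {ε} (Group.inverseʳ GL g)) det-ε)))

  open RawSemiringDefinitions (Semiring.rawSemiring semiring) using (_^_)

  det-^ : ∀ g k → det (g ^ᴬ k) ≈ det g ^ k
  det-^ g zero    = det-ε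
  det-^ g (suc k) = trans (det-∙ g (g ^ᴬ k)) (*-congˡ (det-^ g k))

  finiteOrder⇒det≈±1 : ∀ g → HasFiniteOrder g → det g ≈ 1# ⊎ det g ≈ - 1#
  finiteOrder⇒det≈±1 g (k , gᵏ≈1) = root-of-unity (det g) k
    (trans (sym (det-^ g (suc k))) (trans (det-cong {g ^ᴬ suc k} {ε} gᵏ≈1) det-ε))

-- Finite order from finiteness

module FiniteSubsets (G : Group c ℓ) where
  open Group G
  open GroupTheory G
  open GroupProperties G using (∙-cancelˡ)
  open MonoidMultiplication monoid using (×-homo-+)

  -- Two of the powers of g coincide when one more of them is taken than the list has entries.
  finite⇒finiteOrder : ∀ {W : Pred Carrier ω} → IsFinite W → ∀ g → (∀ k → (g ^ k) ∈ W) → HasFiniteOrder g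
  finite⇒finiteOrder {W = W} (gs , W⊆gs , _) g powers = go (pigeonhole (ℕ.n<1+n _) (Any.index ∘ listed))
    where
    listed : (i : Fin (suc (List.length gs))) → _
    listed i = W⊆gs (powers (toℕ i))
    go : _ → HasFiniteOrder g
    go (i , j , i<j , same) = k , ∙-cancelˡ (g ^ toℕ i) _ _ (trans (sym (×-homo-+ g (toℕ i) (suc k))) (trans
        (reflexive (≡.cong (g ^_) (≡.trans (ℕ.+-suc (toℕ i) k) (ℕ.m+[n∸m]≡n i<j))))
        (trans equal (sym (identityʳ _)))))
      where
      -- `HasFiniteOrder` uses the exponent `suc k`, which is to be j - i; hence one less here.
      k = toℕ j ℕ.∸ suc (toℕ i)
      equal : g ^ toℕ j ≈ g ^ toℕ i
      equal = trans (Any.lookup-index (listed j)) (trans (reflexive (≡.cong (List.lookup gs) (≡.sym same))) (sym (Any.lookup-index (listed i))))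

-- Finite order and the action modulo the fixed space

module CoxeterGroups (ℝ : RealField c ℓ₁ ℓ₂) (V : Module (RealField.commutativeRing ℝ) μ ℓμ)
             (fd : Dimension.FiniteDimensional V) where
  open RealField ℝ using (commutativeRing)
  open CommutativeRing commutativeRing hiding (zero)
  open Module V
  open LinearAlgebra ℝ V
  open Complements ℝ V
  open AutomorphismDeterminants ℝ V fd
  open GeneralLinear V
  open Reflections V fd
  open FiniteDimensional fd
  open Determinants commutativeRing
    using (unit; unit-sym; determinant-cong; determinant-unit; determinant-first-row; determinant-first-two-rows; SquareMatrix)
  open Group GL using (_∙_; ε; _⁻¹) renaming (_≈_ to _≈ᴬ_)
  open GroupTheory GL using (HasFiniteOrder; ⟨_⟩; generator; respects; identity; product; inverse) renaming (_^_ to _^ᴬ_)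
  private
    module S = IntegerSolver commutativeRing
    module A = Automorphism
  open S using (var; con; _:+_; _:*_; :-_)

  -- For δ = g v - v fixed by g, induction gives g^k v = v + k δ. Some positive multiple of δ is
  -- therefore zero, and so is δ in characteristic zero.
  finiteOrder⇒no-unipotent : ∀ g → HasFiniteOrder g → ∀ v → ⟦ g ⟧ (⟦ g ⟧ v +ᴹ -ᴹ v) ≈ᴹ ⟦ g ⟧ v +ᴹ -ᴹ v → ⟦ g ⟧ v ≈ᴹ v
  finiteOrder⇒no-unipotent g (k , gᵏ≈1) v gδ≈δ = begin
    ⟦ g ⟧ v       ≈⟨ gv≈v+δ ⟩
    v +ᴹ δ        ≈⟨ +ᴹ-congˡ δ≈0 ⟩
    v +ᴹ 0ᴹ       ≈⟨ +ᴹ-identityʳ v ⟩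
    v             ∎
    where
    open SetoidReasoning ≈ᴹ-setoid
    δ = ⟦ g ⟧ v +ᴹ -ᴹ v
    gv≈v+δ : ⟦ g ⟧ v ≈ᴹ v +ᴹ δ
    gv≈v+δ = solveᴹ [] (v ▸ ⟦ g ⟧ v ▸ []) (vec 1F) (vec 0F ⊕ (vec 1F ⊕ ⊝ vec 0F)) (refl , refl , tt)
    power : ∀ k → ⟦ g ^ᴬ k ⟧ v ≈ᴹ v +ᴹ fromℕ k *ₗ δ
    power zero    = ≈ᴹ-sym (≈ᴹ-trans (+ᴹ-congˡ (*ₗ-zeroˡ δ)) (+ᴹ-identityʳ v))
    power (suc k) = begin
      ⟦ g ⟧ (⟦ g ^ᴬ k ⟧ v)                 ≈⟨ A.⟦⟧-cong g (power k) ⟩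
      ⟦ g ⟧ (v +ᴹ fromℕ k *ₗ δ)            ≈⟨ A.+ᴹ-homo g v _ ⟩
      ⟦ g ⟧ v +ᴹ ⟦ g ⟧ (fromℕ k *ₗ δ)      ≈⟨ +ᴹ-cong gv≈v+δ (≈ᴹ-trans (A.*ₗ-homo g (fromℕ k) δ) (*ₗ-congˡ gδ≈δ)) ⟩
      (v +ᴹ δ) +ᴹ fromℕ k *ₗ δ             ≈⟨ solveᴹ (fromℕ k ▸ []) (v ▸ δ ▸ []) ((vec 0F ⊕ vec 1F) ⊕ var 0F ⊛ vec 1F) (vec 0F ⊕ (con (+ 1) :+ var 0F) ⊛ vec 1F) (refl , refl , tt) ⟩
      v +ᴹ fromℕ (suc k) *ₗ δ              ∎
    δ≈0 : δ ≈ᴹ 0ᴹ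
    δ≈0 = *ₗ-cancel (fromℕ-suc≉0 k) (begin
      fromℕ (suc k) *ₗ δ
        ≈⟨ solveᴹ (fromℕ (suc k) ▸ []) (v ▸ δ ▸ []) (var 0F ⊛ vec 1F) ((vec 0F ⊕ var 0F ⊛ vec 1F) ⊕ ⊝ vec 0F) (refl , refl , tt) ⟩
      (v +ᴹ fromℕ (suc k) *ₗ δ) +ᴹ -ᴹ v   ≈⟨ +ᴹ-congʳ (≈ᴹ-trans (≈ᴹ-sym (power (suc k))) (gᵏ≈1 v)) ⟩
      v +ᴹ -ᴹ v                            ≈⟨ -ᴹ‿inverseʳ v ⟩
      0ᴹ                                   ∎)

  fixed-closed : ∀ g a {v w} → FixedSpace g v → FixedSpace g w → FixedSpace g (a *ₗ v +ᴹ w)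
  fixed-closed g a gv≈v gw≈w = ≈ᴹ-trans (A.+ᴹ-homo g _ _) (+ᴹ-cong (≈ᴹ-trans (A.*ₗ-homo g a _) (*ₗ-congˡ gv≈v)) gw≈w)

  fixed-lc : ∀ g {d} {u : Vector Carrierᴹ d} → (∀ j → FixedSpace g (u j)) → ∀ b → FixedSpace g (linearCombination b u)
  fixed-lc g {u = u} fixed b = ≈ᴹ-trans (image-lc g b u) (lc-cong (λ _ → refl) fixed)

  module FixedComplement (g : Automorphism) {k d} {e : Vector Carrierᴹ k} {u : Vector Carrierᴹ d}
                         (isBasis : IsBasis (FixedSpace g) u) (complement : IsComplement e u) where
    open IsComplement complement
    open IsBasis isBasis using (within) renaming (spanning to fixed-spanning)

    image : ∀ v → ⟦ g ⟧ v ≈ᴹ linearCombination (λ i → coordinate i v) (⟦ g ⟧ ∘ e) +ᴹ linearCombination (remainder v) u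
    image v = ≈ᴹ-trans (A.⟦⟧-cong g (decompose v)) (≈ᴹ-trans (A.+ᴹ-homo g _ _)
      (+ᴹ-cong (image-lc g _ e) (fixed-lc g within (remainder v))))

    coordinate-fixed : ∀ {v} → FixedSpace g v → ∀ i → coordinate i v ≈ 0#
    coordinate-fixed {v} gv≈v i = trans (Functional.cong (functional i) (≈ᴹ-sym (proj₂ (fixed-spanning v gv≈v)))) (coordinate-lc i _)

    fixed-coordinate : ∀ {v} → (∀ i → coordinate i v ≈ 0#) → FixedSpace g v
    fixed-coordinate {v} p = ≈ᴹ-trans (A.⟦⟧-cong g v≈) (≈ᴹ-trans (fixed-lc g within (remainder v)) (≈ᴹ-sym v≈))
      where
      v≈ : v ≈ᴹ linearCombination (remainder v) u
      v≈ = ≈ᴹ-trans (decompose v) (≈ᴹ-trans (+ᴹ-congʳ (lc-zero e p)) (+ᴹ-identityˡ _))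

    -- The coordinates along e vanish exactly on V^g, so they describe V / V^g. A class fixed by g
    -- there means that g v - v is fixed by g, hence v itself is fixed and its class is zero.
    unipotent-coordinate : HasFiniteOrder g → ∀ v → (∀ i → coordinate i (⟦ g ⟧ v) ≈ coordinate i v) → ∀ i → coordinate i v ≈ 0#
    unipotent-coordinate order v p = coordinate-fixed (finiteOrder⇒no-unipotent g order v (fixed-coordinate (λ i →
      trans (Functional.+-homo (functional i) _ _) (trans (+-congˡ (Functional.neg-homo (functional i) v)) (x≈y⇒x-y≈0 (p i))))))

  -- Determinants of reflections and rotations

  record ReflectionData (s : Automorphism) : Set (c ⊔ ℓ₁ ⊔ μ ⊔ ℓμ) where
    field
      {d}         : ℕ
      codimension : suc d ≡ dimension
      {u}         : Vector Carrierᴹ d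
      isBasisᵘ    : IsBasis (FixedSpace s) u
      φ           : Functional
      α           : Carrierᴹ
      φα≈2        : ⟪ φ ⟫ α ≈ 2#
      action      : ∀ v → ⟦ s ⟧ v ≈ᴹ v +ᴹ -ᴹ (⟪ φ ⟫ v *ₗ α)
      det≈-1      : det s ≈ - 1#

  -- φ is the coordinate along a vector e₀ outside the hyperplane, and α = e₀ - s e₀. In the basis
  -- e₀, u the matrix is triangular with corner a = φ(s e₀), so det s = a is 1 or -1. Once a = 1 is
  -- excluded, φ(α) = 1 - a = 2.
  reflectionData : ∀ {s} → IsReflection s → ReflectionData s
  reflectionData {s} (order , d , (u , isBasisᵘ) , d+1≡n) with complement fd 1 (IsBasis.independent isBasisᵘ) (≡.trans (ℕ.+-comm 1 d) d+1≡n)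
  ... | e , e-complement = record
    { codimension = ≡.trans (ℕ.+-comm 1 d) d+1≡n
    ; isBasisᵘ    = isBasisᵘ
    ; φ           = φ
    ; α           = α
    ; φα≈2        = trans φα≈1-a (trans (+-congˡ (-‿cong a≈-1)) (S.solve 0 (con (+ 1) :+ :- :- con (+ 1) S.:= con (+ 1) :+ con (+ 1)) refl))
    ; action      = action
    ; det≈-1      = trans det≈a a≈-1
    }
    where
    open IsComplement e-complement
    open FixedComplement s isBasisᵘ e-complement
    φ = functional zero
    module φ = Functional φ
    e₀ = e zero
    α = e₀ +ᴹ -ᴹ ⟦ s ⟧ e₀
    a = ⟪ φ ⟫ (⟦ s ⟧ e₀)

    φα≈1-a : ⟪ φ ⟫ α ≈ 1# + - a
    φα≈1-a = trans (φ.+-homo _ _) (+-cong (coordinate-e zero zero) (φ.neg-homo _))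

    action : ∀ v → ⟦ s ⟧ v ≈ᴹ v +ᴹ -ᴹ (⟪ φ ⟫ v *ₗ α)
    action v = begin
      ⟦ s ⟧ v
        ≈⟨ image v ⟩
      (x *ₗ ⟦ s ⟧ e₀ +ᴹ 0ᴹ) +ᴹ r
        ≈⟨ solveᴹ (x ▸ []) (e₀ ▸ ⟦ s ⟧ e₀ ▸ r ▸ []) ((var 0F ⊛ vec 1F ⊕ 𝟘) ⊕ vec 2F)
             (((var 0F ⊛ vec 0F ⊕ 𝟘) ⊕ vec 2F) ⊕ ⊝ (var 0F ⊛ (vec 0F ⊕ ⊝ vec 1F))) (refl , refl , refl , tt) ⟩
      ((x *ₗ e₀ +ᴹ 0ᴹ) +ᴹ r) +ᴹ -ᴹ (x *ₗ α)
        ≈⟨ +ᴹ-congʳ (decompose v) ⟨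
      v +ᴹ -ᴹ (x *ₗ α) ∎
      where
      open SetoidReasoning ≈ᴹ-setoid
      x = ⟪ φ ⟫ v
      r = linearCombination (remainder v) u

    M : SquareMatrix (suc d)
    M i zero    = (a ∷ remainder (⟦ s ⟧ e₀)) i
    M i (suc j) = unit (suc j) i

    represents : Represents (e₀ ∷ u) M s
    represents zero    = ≈ᴹ-trans (decompose (⟦ s ⟧ e₀)) (+ᴹ-congʳ (+ᴹ-identityʳ _))
    represents (suc j) = ≈ᴹ-trans (IsBasis.within isBasisᵘ j) (≈ᴹ-sym (lc-unit (e₀ ∷ u) (suc j)))

    det≈a : det s ≈ a
    det≈a = trans
      (det-in-basis (≡.trans (ℕ.+-comm 1 d) d+1≡n)
        (λ v → (⟪ φ ⟫ v ∷ remainder v) , ≈ᴹ-sym (≈ᴹ-trans (decompose v) (+ᴹ-congʳ (+ᴹ-identityʳ _)))) {M} s represents)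
      (trans (determinant-first-row d M (λ _ → refl))
        (trans (*-congˡ (trans (determinant-cong d (λ i k → unit-sym i k)) (determinant-unit d))) (*-identityʳ a)))

    a≈-1 : a ≈ - 1#
    a≈-1 with finiteOrder⇒det≈±1 s order
    ... | inj₂ det≈-1 = trans (sym det≈a) det≈-1
    -- For a = 1 the class of e₀ would be fixed modulo the hyperplane, so its coordinate, which is
    -- 1, would vanish.
    ... | inj₁ det≈1  = ⊥-elim (1≉0 (trans (sym (coordinate-e zero zero)) (unipotent-coordinate order e₀
            (λ { zero → trans (trans (sym det≈a) det≈1) (sym (coordinate-e zero zero)) }) zero)))

  rotation-det : ∀ {r} → IsRotation r → det r ≈ 1#
  rotation-det {r} (order@(k , rᵏ≈1) , d , (u , isBasisᵘ) , d+2≡n) with complement fd 2 (IsBasis.independent isBasisᵘ) (≡.trans (ℕ.+-comm 2 d) d+2≡n)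
  ... | e , e-complement = [ (λ det≈1 → det≈1) , (λ det≈-1 → ⊥-elim (impossible (trans (sym det≈D) det≈-1))) ]′ (finiteOrder⇒det≈±1 r order)
    where
    open IsComplement e-complement
    open FixedComplement r isBasisᵘ e-complement
    module κ (i : Fin 2) = Functional (functional i)

    -- The matrix of r on V / V^r; below, t and D are its trace and determinant.
    A : Fin 2 → Fin 2 → Carrier
    A i j = coordinate i (⟦ r ⟧ (e j))

    M : SquareMatrix (2 ℕ.+ d)
    M i zero          = (A 0F 0F ∷ A 1F 0F ∷ remainder (⟦ r ⟧ (e 0F))) i
    M i (suc zero)    = (A 0F 1F ∷ A 1F 1F ∷ remainder (⟦ r ⟧ (e 1F))) i
    M i (suc (suc j)) = unit (suc (suc j)) i

    family : Vector Carrierᴹ (2 ℕ.+ d)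
    family = e 0F ∷ e 1F ∷ u

    decompose′ : ∀ v → v ≈ᴹ linearCombination (coordinate 0F v ∷ coordinate 1F v ∷ remainder v) family
    decompose′ v = ≈ᴹ-trans (decompose v) (≈ᴹ-trans (+ᴹ-congʳ (+ᴹ-congˡ (+ᴹ-identityʳ _))) (+ᴹ-assoc _ _ _))

    represents : Represents family M r
    represents zero          = decompose′ (⟦ r ⟧ (e 0F))
    represents (suc zero)    = decompose′ (⟦ r ⟧ (e 1F))
    represents (suc (suc j)) = ≈ᴹ-trans (IsBasis.within isBasisᵘ j) (≈ᴹ-sym (lc-unit family (suc (suc j))))

    t D : Carrier
    t = A 0F 0F + A 1F 1F
    D = A 0F 0F * A 1F 1F + - (A 0F 1F * A 1F 0F)

    det≈D : det r ≈ D
    det≈D = trans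
      (det-in-basis (≡.trans (ℕ.+-comm 2 d) d+2≡n) (λ v → (coordinate 0F v ∷ coordinate 1F v ∷ remainder v) , ≈ᴹ-sym (decompose′ v)) {M} r represents)
      (trans (determinant-first-two-rows d M (λ _ → refl) (λ _ → refl))
        (trans (*-congˡ (trans (determinant-cong d (λ i k → unit-sym i k)) (determinant-unit d))) (*-identityʳ D)))

    coordinate-image : ∀ i v → coordinate i (⟦ r ⟧ v) ≈ A i 0F * coordinate 0F v + A i 1F * coordinate 1F v
    coordinate-image i v = trans (κ.cong i (image v)) (trans (κ.+-homo i _ _) (trans
      (+-cong (trans (κ.+-homo i _ _) (+-cong (κ.*-homo i _ _) (trans (κ.+-homo i _ _) (+-cong (κ.*-homo i _ _) (κ.0-homo i)))))
              (coordinate-lc i (remainder v)))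
      (S.solve 4 (λ x a y b → (x :* a :+ (y :* b :+ con (+ 0))) :+ con (+ 0) S.:= a :* x :+ b :* y) refl
        (coordinate 0F v) (A i 0F) (coordinate 1F v) (A i 1F))))

    cayley-hamilton : ∀ i v → coordinate i (⟦ r ⟧ (⟦ r ⟧ v)) ≈ t * coordinate i (⟦ r ⟧ v) + - D * coordinate i v
    cayley-hamilton i v = trans (coordinate-image i (⟦ r ⟧ v)) (trans
      (+-cong (*-congˡ (coordinate-image 0F v)) (*-congˡ (coordinate-image 1F v)))
      (trans (expansion i) (+-congʳ (*-congˡ (sym (coordinate-image i v))))))
      where
      x = coordinate 0F v
      y = coordinate 1F v
      expansion : ∀ i → A i 0F * (A 0F 0F * x + A 0F 1F * y) + A i 1F * (A 1F 0F * x + A 1F 1F * y) ≈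
        t * (A i 0F * x + A i 1F * y) + - D * coordinate i v
      expansion zero = S.solve 6 (λ a b c d x y → a :* (a :* x :+ b :* y) :+ b :* (c :* x :+ d :* y) S.:=
        (a :+ d) :* (a :* x :+ b :* y) :+ :- (a :* d :+ :- (b :* c)) :* x) refl (A 0F 0F) (A 0F 1F) (A 1F 0F) (A 1F 1F) x y
      expansion (suc zero) = S.solve 6 (λ a b c d x y → c :* (a :* x :+ b :* y) :+ d :* (c :* x :+ d :* y) S.:=
        (a :+ d) :* (c :* x :+ d :* y) :+ :- (a :* d :+ :- (b :* c)) :* y) refl (A 0F 0F) (A 0F 1F) (A 1F 0F) (A 1F 1F) x y

    impossible : ¬ D ≈ - 1#
    impossible D≈-1 with t ≟ 0#
    -- The contradiction is read off the trace: r acts as -1 on the quotient, so both diagonal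
    -- entries are -1 and t = -2.
    ... | yes t≈0 = 2≉0 (begin
      1# + 1#                        ≈⟨ S.solve 0 (con (+ 1) :+ con (+ 1) S.:= :- (:- con (+ 1) :+ :- con (+ 1))) refl ⟩
      - (- 1# + - 1#)                ≈⟨ -‿cong (+-cong (diagonal 0F) (diagonal 1F)) ⟨
      - (A 0F 0F + A 1F 1F)          ≈⟨ -‿cong t≈0 ⟩
      - 0#                           ≈⟨ S.solve 0 (:- con (+ 0) S.:= con (+ 0)) refl ⟩
      0#                             ∎)
      where
      open SetoidReasoning setoid
      involution : ∀ i v → coordinate i (⟦ r ⟧ (⟦ r ⟧ v)) ≈ coordinate i v
      involution i v = trans (cayley-hamilton i v) (trans (+-cong (*-congʳ t≈0) (*-congʳ (-‿cong D≈-1)))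
        (S.solve 2 (λ x y → con (+ 0) :* x :+ :- :- con (+ 1) :* y S.:= y) refl _ (coordinate i v)))
      negation : ∀ i v → coordinate i (⟦ r ⟧ v +ᴹ v) ≈ 0#
      negation i v = unipotent-coordinate order (⟦ r ⟧ v +ᴹ v) (λ i → trans (κ.cong i (A.+ᴹ-homo r _ _)) (trans (κ.+-homo i _ _)
        (trans (+-congʳ (involution i v)) (trans (+-comm _ _) (sym (κ.+-homo i _ _)))))) i
      unit-diagonal : ∀ (i : Fin 2) → unit i i ≈ 1#
      unit-diagonal zero       = refl
      unit-diagonal (suc zero) = refl
      diagonal : ∀ i → A i i ≈ - 1#
      diagonal i = x-y≈0⇒x≈y (begin
        A i i + - - 1#                   ≈⟨ +-congˡ (S.solve 0 (:- :- con (+ 1) S.:= con (+ 1)) refl) ⟩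
        A i i + 1#                       ≈⟨ +-congˡ (trans (coordinate-e i i) (unit-diagonal i)) ⟨
        A i i + coordinate i (e i)       ≈⟨ κ.+-homo i _ _ ⟨
        coordinate i (⟦ r ⟧ (e i) +ᴹ e i) ≈⟨ negation i (e i) ⟩
        0#                               ∎)
    -- The orbit starts at the preimage of `e 0F` under r, so that x_1 is the coordinate of `e 0F`
    -- along itself, namely 1, and t x_1 = 0 is absurd.
    ... | no t≉0 = 1≉0 (trans (sym (coordinate-e 0F 0F)) (trans (κ.cong 0F (≈ᴹ-sym (Group.inverseʳ GL r (e 0F))))
        (*-cancel-0 t≉0 (periodic-recurrence t (orbit (⟦ r ⁻¹ ⟧ (e 0F))) (recurrence (⟦ r ⁻¹ ⟧ (e 0F))) k
          (κ.cong 0F (rᵏ≈1 _)) (κ.cong 0F (A.⟦⟧-cong r (rᵏ≈1 _)))))))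
      where
      orbit : Carrierᴹ → ℕ → Carrier
      orbit v k = coordinate 0F (⟦ r ^ᴬ k ⟧ v)
      recurrence : ∀ v k → orbit v (2 ℕ.+ k) ≈ t * orbit v (suc k) + orbit v k
      recurrence v k = trans (cayley-hamilton 0F (⟦ r ^ᴬ k ⟧ v)) (+-congˡ (trans (*-congʳ (-‿cong D≈-1))
        (S.solve 1 (λ x → :- :- con (+ 1) :* x S.:= x) refl _)))

  -- Products of two reflections

  module ReflectionProperties {s} (data′ : ReflectionData s) where
    open ReflectionData data′
    private module φ = Functional φ

    φ-reflect : ∀ v → ⟪ φ ⟫ (⟦ s ⟧ v) ≈ - ⟪ φ ⟫ v
    φ-reflect v = trans (φ.cong (action v)) (trans (φ.+-homo _ _) (trans
      (+-congˡ (trans (φ.neg-homo _) (-‿cong (trans (φ.*-homo _ α) (*-congˡ φα≈2)))))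
      (S.solve 1 (λ x → x :+ :- (x :* (con (+ 1) :+ con (+ 1))) S.:= :- x) refl (⟪ φ ⟫ v))))

    involutive : ∀ v → ⟦ s ⟧ (⟦ s ⟧ v) ≈ᴹ v
    involutive v = ≈ᴹ-trans (action (⟦ s ⟧ v)) (≈ᴹ-trans (+ᴹ-cong (action v) (-ᴹ‿cong (*ₗ-congʳ (φ-reflect v))))
      (solveᴹ (⟪ φ ⟫ v ▸ []) (v ▸ α ▸ []) ((vec 0F ⊕ ⊝ (var 0F ⊛ vec 1F)) ⊕ ⊝ (:- var 0F ⊛ vec 1F)) (vec 0F) (refl , refl , tt)))

    fixed⇒φ≈0 : ∀ {v} → FixedSpace s v → ⟪ φ ⟫ v ≈ 0#
    fixed⇒φ≈0 {v} sv≈v = *-cancel-0 2≉0 (trans (S.solve 1 (λ x → (con (+ 1) :+ con (+ 1)) :* x S.:= x :+ :- :- x) refl (⟪ φ ⟫ v))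
      (x≈y⇒x-y≈0 (trans (φ.cong (≈ᴹ-sym sv≈v)) (φ-reflect v))))

    φ≈0⇒fixed : ∀ {v} → ⟪ φ ⟫ v ≈ 0# → FixedSpace s v
    φ≈0⇒fixed {v} φv≈0 = ≈ᴹ-trans (action v) (≈ᴹ-trans (+ᴹ-congˡ (-ᴹ‿cong (≈ᴹ-trans (*ₗ-congʳ φv≈0) (*ₗ-zeroˡ α))))
      (solveᴹ [] (v ▸ []) (vec 0F ⊕ ⊝ 𝟘) (vec 0F) (refl , tt)))

    negates-α : ⟦ s ⟧ α ≈ᴹ -ᴹ α
    negates-α = ≈ᴹ-trans (action α) (≈ᴹ-trans (+ᴹ-congˡ (-ᴹ‿cong (*ₗ-congʳ φα≈2)))
      (solveᴹ [] (α ▸ []) (vec 0F ⊕ ⊝ ((con (+ 1) :+ con (+ 1)) ⊛ vec 0F)) (⊝ vec 0F) (refl , tt)))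

  module ProductOfReflections {s s′} (data₁ : ReflectionData s) (data₂ : ReflectionData s′)
                              (order : HasFiniteOrder (s ∙ s′)) where
    open ReflectionData data₁ using (φ; α; φα≈2; action; d; u; isBasisᵘ; codimension)
    open ReflectionData data₂ using () renaming (φ to φ′; α to α′; φα≈2 to φ′α′≈2; action to action′)
    open ReflectionProperties data₁
    open ReflectionProperties data₂ using () renaming (φ≈0⇒fixed to φ′≈0⇒fixed; fixed⇒φ≈0 to fixed⇒φ′≈0; negates-α to negates-α′)
    private
      module φ  = Functional φ
      module φ′ = Functional φ′

    -- φ' vanishes on the kernel of φ and is therefore proportional to φ, which yields φ(s s' v) =
    -- φ(v). So s s' v - v lies in both hyperplanes and is fixed by s s'.
    same-hyperplane : (∀ j → ⟪ φ′ ⟫ (u j) ≈ 0#) → s ∙ s′ ≈ᴬ ε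
    same-hyperplane φ′u≈0 v = finiteOrder⇒no-unipotent (s ∙ s′) order v
      (≈ᴹ-trans (A.⟦⟧-cong s (φ′≈0⇒fixed (φ′-vanishes φδ≈0))) (φ≈0⇒fixed φδ≈0))
      where
      open SetoidReasoning setoid
      φ′-vanishes : ∀ {w} → ⟪ φ ⟫ w ≈ 0# → ⟪ φ′ ⟫ w ≈ 0#
      φ′-vanishes {w} φw≈0 with IsBasis.spanning isBasisᵘ w (φ≈0⇒fixed φw≈0)
      ... | b , b≈w = trans (φ′.cong (≈ᴹ-sym b≈w)) (φ′.lc-homo-0 b u φ′u≈0)
      -- The vector 2 w - φ(w) α is in the kernel of φ because φ(α) = 2, hence also in that of φ'.
      proportional : ∀ w → 2# * ⟪ φ′ ⟫ w ≈ ⟪ φ ⟫ w * ⟪ φ′ ⟫ α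
      proportional w = x-y≈0⇒x≈y (begin
        2# * ⟪ φ′ ⟫ w + - (⟪ φ ⟫ w * ⟪ φ′ ⟫ α)
          ≈⟨ +-cong (φ′.*-homo 2# w) (trans (φ′.neg-homo _) (-‿cong (φ′.*-homo _ α))) ⟨
        ⟪ φ′ ⟫ (2# *ₗ w) + ⟪ φ′ ⟫ (-ᴹ (⟪ φ ⟫ w *ₗ α))
          ≈⟨ φ′.+-homo _ _ ⟨
        ⟪ φ′ ⟫ (2# *ₗ w +ᴹ -ᴹ (⟪ φ ⟫ w *ₗ α))
          ≈⟨ φ′-vanishes (trans (φ.+-homo _ _) (trans
               (+-cong (φ.*-homo 2# w) (trans (φ.neg-homo _) (-‿cong (trans (φ.*-homo _ α) (*-congˡ φα≈2)))))
               (S.solve 2 (λ t x → t :* x :+ :- (x :* t) S.:= con (+ 0)) refl 2# (⟪ φ ⟫ w)))) ⟩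
        0# ∎)
      -- Doubling the left side gives φ(v) φ'(α) φ(α'), and `proportional` at α' shows φ'(α) φ(α') =
      -- 4.
      product≈2φ : ⟪ φ′ ⟫ v * ⟪ φ ⟫ α′ ≈ 2# * ⟪ φ ⟫ v
      product≈2φ = x-y≈0⇒x≈y (*-cancel-0 2≉0 (begin
        2# * (⟪ φ′ ⟫ v * ⟪ φ ⟫ α′ + - (2# * ⟪ φ ⟫ v))
          ≈⟨ S.solve 4 (λ t f g x → t :* (f :* g :+ :- (t :* x)) S.:= (t :* f) :* g :+ :- (x :* (t :* t))) refl 2# (⟪ φ′ ⟫ v) (⟪ φ ⟫ α′) (⟪ φ ⟫ v) ⟩
        (2# * ⟪ φ′ ⟫ v) * ⟪ φ ⟫ α′ + - (⟪ φ ⟫ v * (2# * 2#))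
          ≈⟨ +-cong (*-congʳ (proportional v)) (-‿cong (*-congˡ (trans (*-congˡ (sym φ′α′≈2)) (proportional α′)))) ⟩
        (⟪ φ ⟫ v * ⟪ φ′ ⟫ α) * ⟪ φ ⟫ α′ + - (⟪ φ ⟫ v * (⟪ φ ⟫ α′ * ⟪ φ′ ⟫ α))
          ≈⟨ S.solve 3 (λ x f g → (x :* f) :* g :+ :- (x :* (g :* f)) S.:= con (+ 0)) refl (⟪ φ ⟫ v) (⟪ φ′ ⟫ α) (⟪ φ ⟫ α′) ⟩
        0# ∎))
      φδ≈0 : ⟪ φ ⟫ (⟦ s ∙ s′ ⟧ v +ᴹ -ᴹ v) ≈ 0#
      φδ≈0 = begin
        ⟪ φ ⟫ (⟦ s ⟧ (⟦ s′ ⟧ v) +ᴹ -ᴹ v)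
          ≈⟨ trans (φ.+-homo _ _) (+-cong (φ-reflect _) (φ.neg-homo v)) ⟩
        - ⟪ φ ⟫ (⟦ s′ ⟧ v) + - ⟪ φ ⟫ v
          ≈⟨ +-congʳ (-‿cong (trans (φ.cong (action′ v)) (trans (φ.+-homo _ _) (+-congˡ (trans (φ.neg-homo _)
               (-‿cong (trans (φ.*-homo _ α′) product≈2φ))))))) ⟩
        - (⟪ φ ⟫ v + - (2# * ⟪ φ ⟫ v)) + - ⟪ φ ⟫ v
          ≈⟨ S.solve 1 (λ x → :- (x :+ :- ((con (+ 1) :+ con (+ 1)) :* x)) :+ :- x S.:= con (+ 0)) refl (⟪ φ ⟫ v) ⟩
        0# ∎

    -- If s s' v = v then s' v = s v, so φ'(v) α' = φ(v) α. Were φ'(v) nonzero, the roots would be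
    -- parallel although w separates the hyperplanes.
    fixed-by-both : ∀ {w} → FixedSpace s w → ¬ ⟪ φ′ ⟫ w ≈ 0# → FixedSpace (s ∙ s′) ≐ FixedSpace s ∩ Ker φ′
    fixed-by-both {w} sw≈w φ′w≉0 = to , λ (sv≈v , φ′v≈0) → ≈ᴹ-trans (A.⟦⟧-cong s (φ′≈0⇒fixed φ′v≈0)) sv≈v
      where
      open SetoidReasoning ≈ᴹ-setoid
      roots-related : ∀ {v} → FixedSpace (s ∙ s′) v → ⟪ φ′ ⟫ v *ₗ α′ ≈ᴹ ⟪ φ ⟫ v *ₗ α
      roots-related {v} xv≈v = begin
        ⟪ φ′ ⟫ v *ₗ α′
          ≈⟨ solveᴹ (⟪ φ′ ⟫ v ▸ []) (v ▸ α′ ▸ []) (var 0F ⊛ vec 1F) (vec 0F ⊕ ⊝ (vec 0F ⊕ ⊝ (var 0F ⊛ vec 1F))) (refl , refl , tt) ⟩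
        v +ᴹ -ᴹ (v +ᴹ -ᴹ (⟪ φ′ ⟫ v *ₗ α′))
          ≈⟨ +ᴹ-congˡ (-ᴹ‿cong (≈ᴹ-trans (≈ᴹ-sym (action′ v)) (≈ᴹ-trans (≈ᴹ-sym (involutive _)) (≈ᴹ-trans (A.⟦⟧-cong s xv≈v) (action v))))) ⟩
        v +ᴹ -ᴹ (v +ᴹ -ᴹ (⟪ φ ⟫ v *ₗ α))
          ≈⟨ solveᴹ (⟪ φ ⟫ v ▸ []) (v ▸ α ▸ []) (vec 0F ⊕ ⊝ (vec 0F ⊕ ⊝ (var 0F ⊛ vec 1F))) (var 0F ⊛ vec 1F) (refl , refl , tt) ⟩
        ⟪ φ ⟫ v *ₗ α ∎

      -- Parallel roots α and α′ would make s ∙ s′ unipotent in the direction of w.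
      not-parallel : ∀ p q → p *ₗ α′ ≈ᴹ q *ₗ α → ¬ p ≈ 0# → ⊥
      not-parallel p q pα′≈qα p≉0 = φ′w≉0 (fixed⇒φ′≈0 (begin
        ⟦ s′ ⟧ w               ≈⟨ involutive _ ⟨
        ⟦ s ⟧ (⟦ s ∙ s′ ⟧ w)   ≈⟨ A.⟦⟧-cong s (finiteOrder⇒no-unipotent (s ∙ s′) order w (≈ᴹ-trans (A.⟦⟧-cong (s ∙ s′) δ≈)
                                    (≈ᴹ-trans (A.*ₗ-homo (s ∙ s′) _ α′) (≈ᴹ-trans (*ₗ-congˡ α′-fixed) (≈ᴹ-sym δ≈))))) ⟩
        ⟦ s ⟧ w                ≈⟨ sw≈w ⟩
        w                      ∎))
        where
        x = ⟪ φ′ ⟫ w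
        y = ⟪ φ ⟫ α′
        py≈q2 : p * y ≈ q * 2#
        py≈q2 = trans (sym (φ.*-homo p α′)) (trans (φ.cong pα′≈qα) (trans (φ.*-homo q α) (*-congˡ φα≈2)))
        -- Applying φ to p α' = q α gives p y = 2 q; this eliminates the unknown ratio of the roots
        -- without dividing.
        yα≈2α′ : y *ₗ α ≈ᴹ 2# *ₗ α′
        yα≈2α′ = begin
          y *ₗ α                                        ≈⟨ solveᴹ (y ▸ []) (α ▸ α′ ▸ []) (var 0F ⊛ vec 0F)
                                                             ((con (+ 1) :+ con (+ 1)) ⊛ vec 1F ⊕ (var 0F ⊛ vec 0F ⊕ ⊝ ((con (+ 1) :+ con (+ 1)) ⊛ vec 1F))) (refl , refl , tt) ⟩
          2# *ₗ α′ +ᴹ (y *ₗ α +ᴹ -ᴹ (2# *ₗ α′))         ≈⟨ +ᴹ-congˡ (*ₗ-cancel p≉0 zero′) ⟩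
          2# *ₗ α′ +ᴹ 0ᴹ                                ≈⟨ +ᴹ-identityʳ _ ⟩
          2# *ₗ α′                                      ∎
          where
          zero′ : p *ₗ (y *ₗ α +ᴹ -ᴹ (2# *ₗ α′)) ≈ᴹ 0ᴹ
          zero′ = begin
            p *ₗ (y *ₗ α +ᴹ -ᴹ (2# *ₗ α′))
              ≈⟨ solveᴹ (p ▸ y ▸ 2# ▸ []) (α ▸ α′ ▸ []) (var 0F ⊛ (var 1F ⊛ vec 0F ⊕ ⊝ (var 2F ⊛ vec 1F)))
                   ((var 0F :* var 1F) ⊛ vec 0F ⊕ ⊝ (var 2F ⊛ (var 0F ⊛ vec 1F))) (refl , refl , tt) ⟩
            (p * y) *ₗ α +ᴹ -ᴹ (2# *ₗ p *ₗ α′)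
              ≈⟨ +ᴹ-cong (*ₗ-congʳ py≈q2) (-ᴹ‿cong (*ₗ-congˡ pα′≈qα)) ⟩
            (q * 2#) *ₗ α +ᴹ -ᴹ (2# *ₗ q *ₗ α)
              ≈⟨ solveᴹ (q ▸ 2# ▸ []) (α ▸ []) ((var 0F :* var 1F) ⊛ vec 0F ⊕ ⊝ (var 1F ⊛ (var 0F ⊛ vec 0F))) 𝟘 (refl , tt) ⟩
            0ᴹ ∎
        sα′≈-α′ : ⟦ s ⟧ α′ ≈ᴹ -ᴹ α′
        sα′≈-α′ = ≈ᴹ-trans (action α′) (≈ᴹ-trans (+ᴹ-congˡ (-ᴹ‿cong yα≈2α′))
          (solveᴹ [] (α′ ▸ []) (vec 0F ⊕ ⊝ ((con (+ 1) :+ con (+ 1)) ⊛ vec 0F)) (⊝ vec 0F) (refl , tt)))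
        α′-fixed : ⟦ s ∙ s′ ⟧ α′ ≈ᴹ α′
        α′-fixed = ≈ᴹ-trans (A.⟦⟧-cong s negates-α′) (≈ᴹ-trans (A.-ᴹ-homo s α′) (≈ᴹ-trans (-ᴹ‿cong sα′≈-α′)
          (solveᴹ [] (α′ ▸ []) (⊝ ⊝ vec 0F) (vec 0F) (refl , tt))))
        δ≈ : ⟦ s ∙ s′ ⟧ w +ᴹ -ᴹ w ≈ᴹ x *ₗ α′
        δ≈ = begin
          ⟦ s ⟧ (⟦ s′ ⟧ w) +ᴹ -ᴹ w
            ≈⟨ +ᴹ-congʳ (≈ᴹ-trans (A.⟦⟧-cong s (action′ w)) (≈ᴹ-trans (A.+ᴹ-homo s _ _) (+ᴹ-cong sw≈w
                 (≈ᴹ-trans (A.-ᴹ-homo s _) (-ᴹ‿cong (≈ᴹ-trans (A.*ₗ-homo s x α′) (*ₗ-congˡ sα′≈-α′))))))) ⟩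
          (w +ᴹ -ᴹ (x *ₗ (-ᴹ α′))) +ᴹ -ᴹ w
            ≈⟨ solveᴹ (x ▸ []) (w ▸ α′ ▸ []) ((vec 0F ⊕ ⊝ (var 0F ⊛ ⊝ vec 1F)) ⊕ ⊝ vec 0F) (var 0F ⊛ vec 1F) (refl , refl , tt) ⟩
          x *ₗ α′ ∎

      to : ∀ {v} → FixedSpace (s ∙ s′) v → FixedSpace s v × ⟪ φ′ ⟫ v ≈ 0#
      to {v} xv≈v with ⟪ φ′ ⟫ v ≟ 0#
      ... | no  φ′v≉0 = ⊥-elim (not-parallel _ _ (roots-related xv≈v) φ′v≉0)
      ... | yes φ′v≈0 = ≈ᴹ-trans (≈ᴹ-sym (A.⟦⟧-cong s (φ′≈0⇒fixed φ′v≈0))) xv≈v , φ′v≈0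

    trivial-or-rotation : s ∙ s′ ≈ᴬ ε ⊎ IsRotation (s ∙ s′)
    trivial-or-rotation with any? (λ j → ¬? (⟪ φ′ ⟫ (u j) ≟ 0#))
    ... | no  none         = inj₁ (same-hyperplane (λ j → decidable-stable (_ ≟ 0#) (λ ≉0 → none (j , ≉0))))
    ... | yes (i , φ′uᵢ≉0) = inj₂ (order , codimension-2 codimension isBasisᵘ i φ′uᵢ≉0)
      where
      -- Stated for arbitrary d so that d can be matched: an index i in `Fin d` makes it a
      -- successor, as `kernel-dimension` requires.
      codimension-2 : ∀ {d} {u : Vector Carrierᴹ d} → suc d ≡ dimension → IsBasis (FixedSpace s) u →
        ∀ i → ¬ ⟪ φ′ ⟫ (u i) ≈ 0# → HasCodimension (FixedSpace (s ∙ s′)) 2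
      codimension-2 {suc d} n isBasis i φ′uᵢ≉0 with kernel-dimension isBasis (λ a → fixed-closed s a) φ′ i φ′uᵢ≉0 | fixed-by-both (IsBasis.within isBasis i) φ′uᵢ≉0
      ... | b , b-isBasis | to , from = d , (b , basis-resp ((λ {v} → from {v}) , (λ {v} → to {v})) b-isBasis) , ≡.trans (ℕ.+-comm d 2) n

  -- Equality of the rotation subgroup and the alternating subgroup

  module _ {W : Pred Automorphism ω} (coxeter : IsFiniteCoxeterGroup W) where
    open IsFiniteCoxeterGroup coxeter
    private
      module G = Group GL
    open GroupProperties GL using (⁻¹-involutive; ⁻¹-anti-homo-∙; ε⁻¹≈ε; inverseˡ-unique)

    W⊆ : ∀ {g} → W g → ⟨ W ∩ IsReflection ⟩ g
    W⊆ = proj₁ generatedByReflections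

    ⊆W : ∀ {g} → ⟨ W ∩ IsReflection ⟩ g → W g
    ⊆W = proj₂ generatedByReflections

    W-finiteOrder : ∀ {g} → W g → HasFiniteOrder g
    W-finiteOrder {g} g∈W = FiniteSubsets.finite⇒finiteOrder GL finite g powers
      where
      powers : ∀ k → W (g ^ᴬ k)
      powers zero    = ⊆W identity
      powers (suc k) = ⊆W (product (W⊆ g∈W) (W⊆ (powers k)))

    𝓡₂⊆Alt : ∀ {g} → 𝓡₂ W g → Alt W g
    𝓡₂⊆Alt (generator (g∈W , rotation)) = g∈W , rotation-det rotation
    𝓡₂⊆Alt (respects {g} {h} g≈h g∈) with 𝓡₂⊆Alt g∈
    ... | g∈W , det≈1 = ⊆W (respects g≈h (W⊆ g∈W)) , trans (sym (det-cong {g} {h} g≈h)) det≈1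
    𝓡₂⊆Alt identity = ⊆W identity , det-ε
    𝓡₂⊆Alt (product {g} {h} g∈ h∈) with 𝓡₂⊆Alt g∈ | 𝓡₂⊆Alt h∈
    ... | g∈W , detg≈1 | h∈W , deth≈1 = ⊆W (product (W⊆ g∈W) (W⊆ h∈W)) ,
      trans (det-∙ g h) (trans (*-cong detg≈1 deth≈1) (*-identityˡ 1#))
    𝓡₂⊆Alt (inverse {g} g∈) with 𝓡₂⊆Alt g∈
    ... | g∈W , det≈1 = ⊆W (inverse (W⊆ g∈W)) , det-⁻¹ {g} det≈1

    -- The two cases are not exclusive by construction; only the determinant separates them.
    data Parity (h : Automorphism) : Set (c ⊔ ℓ₁ ⊔ μ ⊔ ℓμ ⊔ ω) where
      even : 𝓡₂ W h → Parity h
      odd  : ∀ {s h′} → (W ∩ IsReflection) s → 𝓡₂ W h′ → h ≈ᴬ s ∙ h′ → Parity h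

    parity-resp : ∀ {g h} → g ≈ᴬ h → Parity g → Parity h
    parity-resp {g} {h} g≈h (even g∈) = even (respects {g = g} {h} g≈h g∈)
    parity-resp {g} {h} g≈h (odd {s} {h′} s∈ h′∈ g≈sh′) = odd s∈ h′∈ (G.trans {h} {g} {s ∙ h′} (G.sym {g} {h} g≈h) g≈sh′)

    pair∈𝓡₂ : ∀ {s s′} → (W ∩ IsReflection) s → (W ∩ IsReflection) s′ → 𝓡₂ W (s ∙ s′)
    pair∈𝓡₂ {s} {s′} (s∈W , s-refl) (s′∈W , s′-refl) =
      [ (λ ss′≈ε → respects {g = ε} {s ∙ s′} (G.sym {s ∙ s′} {ε} ss′≈ε) identity) , (λ rotation → generator (ss′∈W , rotation)) ]′
        (ProductOfReflections.trivial-or-rotation (reflectionData s-refl) (reflectionData s′-refl) (W-finiteOrder ss′∈W))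
      where
      ss′∈W : W (s ∙ s′)
      ss′∈W = ⊆W (product (W⊆ s∈W) (W⊆ s′∈W))

    reflection-parity : ∀ {s h} → (W ∩ IsReflection) s → Parity h → Parity (s ∙ h)
    reflection-parity s∈ (even h∈) = odd s∈ h∈ (λ _ → ≈ᴹ-refl)
    reflection-parity {s} {h} s∈ (odd {s′} {h′} s′∈ h′∈ h≈s′h′) =
      even (respects {g = (s ∙ s′) ∙ h′} {s ∙ h} (λ v → A.⟦⟧-cong s (≈ᴹ-sym (h≈s′h′ v))) (product (pair∈𝓡₂ s∈ s′∈) h′∈))

    -- Quantifying over the right factor h makes the product case a composition of two left
    -- multiplications. Carrying the inverse of g along makes the `inverse` case an exchange of the
    -- two components; for a generator both coincide, a reflection being its own inverse.
    parity : ∀ {g} → ⟨ W ∩ IsReflection ⟩ g → ∀ {h} → Parity h → Parity (g ∙ h) × Parity (g ⁻¹ ∙ h)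
    parity (generator {s} s∈@(_ , s-refl)) {h} p = reflection-parity s∈ p ,
      parity-resp {s ∙ h} {s ⁻¹ ∙ h} (λ v → s≈s⁻¹ (⟦ h ⟧ v)) (reflection-parity s∈ p)
      where
      s≈s⁻¹ : s ≈ᴬ s ⁻¹
      s≈s⁻¹ = inverseˡ-unique s s (ReflectionProperties.involutive (reflectionData s-refl))
    parity (respects {g} {g′} g≈g′ g∈) {h} p =
      parity-resp {g ∙ h} {g′ ∙ h} (λ v → g≈g′ (⟦ h ⟧ v)) (proj₁ (parity g∈ p)) ,
      parity-resp {g ⁻¹ ∙ h} {g′ ⁻¹ ∙ h} (λ v → G.⁻¹-cong {g} {g′} g≈g′ (⟦ h ⟧ v)) (proj₂ (parity g∈ p))
    parity identity {h} p = parity-resp {h} {ε ∙ h} (λ _ → ≈ᴹ-refl) p ,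
      parity-resp {h} {ε ⁻¹ ∙ h} (λ v → ≈ᴹ-sym (ε⁻¹≈ε (⟦ h ⟧ v))) p
    parity (product {g} {g′} g∈ g′∈) {h} p =
      parity-resp {g ∙ (g′ ∙ h)} {(g ∙ g′) ∙ h} (λ _ → ≈ᴹ-refl) (proj₁ (parity g∈ (proj₁ (parity g′∈ p)))) ,
      parity-resp {g′ ⁻¹ ∙ (g ⁻¹ ∙ h)} {(g ∙ g′) ⁻¹ ∙ h} (λ v → ≈ᴹ-sym (⁻¹-anti-homo-∙ g g′ (⟦ h ⟧ v)))
        (proj₂ (parity g′∈ (proj₂ (parity g∈ p))))
    parity (inverse {g} g∈) {h} p = proj₂ (parity g∈ p) ,
      parity-resp {g ∙ h} {(g ⁻¹) ⁻¹ ∙ h} (λ v → ≈ᴹ-sym (⁻¹-involutive g (⟦ h ⟧ v))) (proj₁ (parity g∈ p))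

    Alt⊆𝓡₂ : ∀ {g} → Alt W g → 𝓡₂ W g
    Alt⊆𝓡₂ {g} (g∈W , det≈1) with proj₁ (parity (W⊆ g∈W) {ε} (even identity))
    ... | even g∈ = respects {g = g ∙ ε} {g} (λ _ → ≈ᴹ-refl) g∈
    ... | odd {s} {h} (_ , s-refl) h∈ g≈sh = ⊥-elim (1≉-1 (begin
      1#              ≈⟨ det≈1 ⟨
      det g           ≈⟨ det-cong {g} {s ∙ h} g≈sh ⟩
      det (s ∙ h)     ≈⟨ det-∙ s h ⟩
      det s * det h   ≈⟨ *-cong (ReflectionData.det≈-1 (reflectionData s-refl)) (proj₂ (𝓡₂⊆Alt h∈)) ⟩
      - 1# * 1#       ≈⟨ *-identityʳ _ ⟩
      - 1#            ∎))
      where open SetoidReasoning setoid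

    𝓡₂≐Alt : 𝓡₂ W ≐ Alt W
    𝓡₂≐Alt = 𝓡₂⊆Alt , Alt⊆𝓡₂

proposition4p3 : {c ℓ₁ ℓ₂ m ℓm w : Level}
    (ℝ : RealField c ℓ₁ ℓ₂)
    (V : Module (RealField.commutativeRing ℝ) m ℓm)
    (fd : Dimension.FiniteDimensional V)
    (W : Pred (GeneralLinear.Automorphism V) w) →
    Reflections.IsFiniteCoxeterGroup V fd W →
    Reflections.𝓡₂ V fd W ≐ Reflections.Alt V fd W
proposition4p3 ℝ V fd W coxeter = CoxeterGroups.𝓡₂≐Alt ℝ V fd coxeter
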